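{- Every subcubic graph $G$ with $\mathrm{mad}(G) < \frac{9}{4}$ is $(1,2^4)$-packing edge-colorable.
   Context: Graphs are finite and simple. A graph is subcubic if its maximum degree is at most $3$. $\mathrm{mad}(G)$ denotes the maximum average degree, i.e., the maximum of $2|E(H)|/|V(H)|$ over all nonempty subgraphs $H$ of $G$. For distinct edges $e,f$ of $G$, the distance between $e$ and $f$ is the distance between the corresponding vertices of the line graph $L(G)$ (so edges sharing an endpoint are at distance $1$). A graph $G$ is $(1,2^4)$-packing edge-colorable if $E(G)$ can be partitioned into five classes (possibly empty) such that in the first class any two distinct edges are at distance at least $2$ (the class is a matching), and in each of the remaining four classes any two distinct edges are at distance at least $3$ (the class is an induced matching). -}

module Defs where

open import Level using (Level)
open import Data.Bool using (Bool; true; false)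
import Data.Bool.Properties as Bool
open import Data.Nat using (ℕ; zero; suc; _≤_; _<_; _*_)
open import Data.Integer using (+_)
open import Data.Rational using (ℚ; 0ℚ; _/_)
import Data.Rational.Properties as ℚ
open import Data.Fin as Fin using (Fin)
import Data.Fin.Properties as Fin
open import Data.Fin.Subset as Subset using (Subset; ∣_∣; Nonempty; inside; outside)
open import Data.Fin.Subset.Properties using (_∈?_; nonempty?)
open import Data.List using (List; []; _∷_; _++_; map; mapMaybe; filter; length; allFin; cartesianProduct)
open import Data.List.Relation.Unary.All as All using (All)
import Data.List.Extrema
import Data.List.Extrema.Nat as ℕExtrema
open import Data.Maybe using (Maybe; just; nothing)
open import Data.Product using (Σ; ∃; _×_; _,_; uncurry)
open import Data.Sum using (_⊎_)
open import Data.Vec as Vec using (Vec)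
open import Relation.Binary using (Rel; DecTotalOrder)
open import Relation.Binary.PropositionalEquality using (_≡_; _≢_)
open import Relation.Nullary using (Dec; yes; no)
open import Relation.Nullary.Decidable using (_×-dec_)

private
  variable
    a ℓ : Level
    A : Set a
    n k : ℕ

record Graph (n : ℕ) : Set where
  field
    adj    : Fin n → Fin n → Bool
    sym    : ∀ u v → adj u v ≡ adj v u
    irrefl : ∀ v → adj v v ≡ false

open Graph public

neighbours : Graph n → Fin n → Subset n
neighbours G v = Vec.tabulate (adj G v)

degree : Graph n → Fin n → ℕ
degree G v = ∣ neighbours G v ∣

maxDegree : Graph n → ℕ
maxDegree {n} G = ℕExtrema.max 0 (map (degree G) (allFin n))

Subcubic : Graph n → Set
Subcubic G = maxDegree G ≤ 3

-- An undirected edge is stored once, with its endpoints in increasing order.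
-- Both proof fields are propositions, so two edges are equal exactly when
-- they have the same endpoints.
record Edge (G : Graph n) : Set where
  constructor edge
  field
    src tgt  : Fin n
    ordered  : src Fin.< tgt
    adjacent : adj G src tgt ≡ true

open Edge public

edge? : (G : Graph n) → Fin n → Fin n → Maybe (Edge G)
edge? G u v with u Fin.<? v | adj G u v Bool.≟ true
... | yes u<v | yes uv = just (edge u v u<v uv)
... | yes _   | no _   = nothing
... | no _    | _      = nothing

edges : (G : Graph n) → List (Edge G)
edges {n} G = mapMaybe (uncurry (edge? G)) (cartesianProduct (allFin n) (allFin n))

allSubsets : ∀ n → List (Subset n)
allSubsets zero    = Vec.[] ∷ []
allSubsets (suc n) = map (inside Vec.∷_) (allSubsets n) ++ map (outside Vec.∷_) (allSubsets n)

sublists : List A → List (List A)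
sublists []       = [] ∷ []
sublists (x ∷ xs) = map (x ∷_) (sublists xs) ++ sublists xs

-- A pair (V(H) , E(H)). Edges are drawn from sublists of `edges G`, which has
-- no repetitions, so the length of the list is |E(H)|.
SubgraphData : Graph n → Set
SubgraphData {n} G = Subset n × List (Edge G)

IsNonemptySubgraph : (G : Graph n) → SubgraphData G → Set
IsNonemptySubgraph G (V , E) =
  Nonempty V × All (λ e → src e Subset.∈ V × tgt e Subset.∈ V) E

isNonemptySubgraph? : (G : Graph n) (H : SubgraphData G) → Dec (IsNonemptySubgraph G H)
isNonemptySubgraph? G (V , E) =
  nonempty? V ×-dec All.all? (λ e → (src e ∈? V) ×-dec (tgt e ∈? V)) E

-- All nonempty subgraphs of G, not only the induced ones.
nonemptySubgraphs : (G : Graph n) → List (SubgraphData G)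
nonemptySubgraphs {n} G =
  filter (isNonemptySubgraph? G) (cartesianProduct (allSubsets n) (sublists (edges G)))

-- The value at denominator 0 is never used: `nonemptySubgraphs` has V ≠ ∅.
ratio : ℕ → ℕ → ℚ
ratio m zero    = 0ℚ
ratio m (suc d) = + m / suc d

averageDegree : (G : Graph n) → SubgraphData G → ℚ
averageDegree G (V , E) = ratio (2 * length E) ∣ V ∣

open Data.List.Extrema (DecTotalOrder.totalOrder ℚ.≤-decTotalOrder) using (max)

-- Average degrees are nonnegative, so the default 0 only matters for the graph
-- without vertices, whose mad is thereby 0.
mad : Graph n → ℚ
mad G = max 0ℚ (map (averageDegree G) (nonemptySubgraphs G))

_IsEndpointOf_ : {G : Graph n} → Fin n → Edge G → Set
w IsEndpointOf e = w ≡ src e ⊎ w ≡ tgt e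

-- Adjacency in the line graph L(G), whose vertices are the edges of G.
LineAdj : (G : Graph n) → Rel (Edge G) _
LineAdj G e f = e ≢ f × ∃ λ w → w IsEndpointOf e × w IsEndpointOf f

data Walk {A : Set a} (R : Rel A ℓ) : ℕ → A → A → Set (a Level.⊔ ℓ) where
  []  : ∀ {x} → Walk R 0 x x
  _∷_ : ∀ {m x y z} → R x y → Walk R m y z → Walk R (suc m) x z

-- The distance is the least length of a walk, and infinite if there is none.
DistanceAtLeast : {A : Set a} → Rel A ℓ → ℕ → A → A → Set _
DistanceAtLeast R d x y = ∀ m → Walk R m x y → d ≤ m

-- For S = (s₁ , … , s_k): a partition of E(G) into k possibly empty classes,
-- where distinct edges of the i-th class are at distance at least sᵢ + 1 in L(G).
PackingEdgeColorable : Vec ℕ k → Graph n → Set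
PackingEdgeColorable {k} S G =
  Σ (Edge G → Fin k) λ c → ∀ e f → e ≢ f → c e ≡ c f →
    DistanceAtLeast (LineAdj G) (suc (Vec.lookup S (c e))) e f

{-# OPTIONS --safe #-}

{-
Give every vertex three ports, some of which may be dangling, and colour all
ports instead of the edges only. By induction on S, the ports of every vertex set
S can be coloured: a vertex outside S leaves a dangling, still coloured, port at
each of its neighbours in S.

If a vertex of S has at most one neighbour in S, or if S contains a triangle or
4-cycle with all but one vertex of degree 2, or a path of four vertices of degree
2, or a vertex of degree 3 from which threads of at least 3, 2 and 1 vertices of
degree 2 issue, then those vertices can be removed and the colouring extended. A
port restricts the extension only through its state, that is its colour and the
two other colours at its vertex, so this is a finite check.

Otherwise give a vertex of degree d the charge 8 d - 18 and let every vertex of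
degree 3 send 1 to each vertex of degree 2 on its three threads. Threads have at
most 3 vertices, and a vertex of degree 3 sees at most 6 vertices of degree 2,
whence all final charges are nonnegative and S has average degree at least 9/4.
-}
module Submission where

open import Defs hiding (sym; irrefl)
open import Axiom.UniquenessOfIdentityProofs using (module Decidable⇒UIP)
open import Data.Bool as Bool using (true; false; if_then_else_)
import Data.Bool.Properties as Bool
open import Data.Empty using (⊥-elim)
open import Data.Fin as Fin using (Fin; zero; suc; toℕ)
open import Data.Fin.Patterns using (0F; 1F; 2F; 3F)
import Data.Fin.Properties as Fin
open import Data.Fin.Subset using (Subset; _∈_; _∉_; _⊆_; _⊂_; ⊤; inside; outside; ∣_∣; Nonempty)
open import Data.Fin.Subset.Induction using (⊂-wellFounded)
open import Data.Fin.Subset.Properties using (_∈?_; ∈⊤; nonempty?; x∈p⇒∣p-x∣<∣p∣)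
open import Data.Integer as ℤ using (+_)
import Data.Integer.Properties as ℤ
open import Data.List as List
  using (List; []; _∷_; _++_; map; mapMaybe; catMaybes; filter; length; allFin; tabulate; cartesianProduct)
import Data.List.Extrema
import Data.List.Extrema.Nat as ℕExtrema
import Data.List.Membership.DecPropositional as DecMembership
open import Data.List.Membership.Propositional using () renaming (_∈_ to _∈ₗ_; _∉_ to _∉ₗ_)
open import Data.List.Membership.Propositional.Properties
  using (∈-map⁺; ∈-++⁺ˡ; ∈-++⁺ʳ; ∈-filter⁺; ∈-cartesianProduct⁺; ∈-allFin)
import Data.List.Properties as List
open import Data.List.Relation.Unary.All as All using ()
open import Data.List.Relation.Unary.All.Properties using (all-filter)
open import Data.List.Relation.Unary.Any using (here; there)
open import Data.Maybe as Maybe using (Maybe; just; nothing; maybe)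
import Data.Maybe.Properties as Maybe
open import Data.Nat as ℕ using (ℕ; zero; suc; _+_; _*_; _≤_; s≤s; z≤n)
import Data.Nat.Properties as ℕ
open import Algebra.Properties.Semiring.Sum ℕ.+-*-semiring
  using (sum; sum-cong-≗; sum-replicate-zero; ∑-distrib-+; ∑-comm; *-distribˡ-sum)
open import Data.Nat.Tactic.RingSolver using (solve-∀)
open import Data.Product using (∃; ∃₂; _×_; _,_; proj₁; proj₂; swap; uncurry)
open import Data.Rational as ℚ using (0ℚ; _<_; _/_)
import Data.Rational.Properties as ℚ
open import Data.Rational.Unnormalised using (mkℚᵘ; *<*)
import Data.Rational.Unnormalised.Properties as ℚᵘ
open import Data.Sum as Sum using (_⊎_; inj₁; inj₂)
open import Data.Vec as Vec using (_∷_; [])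
import Data.Vec.Properties as Vec
open import Function using (_∘_; case_of_)
import Induction.WellFounded as WellFounded
open import Relation.Binary using (DecTotalOrder; tri<; tri≈; tri>)
open import Relation.Binary.PropositionalEquality
open import Relation.Nullary using (Dec; yes; no; does; ¬_; ¬?)
open import Relation.Nullary.Decidable using (map′; from-yes; dec-true; dec-false; _×-dec_; _⊎-dec_; _→-dec_)
open import Relation.Unary using (Pred; Decidable)

-- States of an edge

-- 0 is the class of the matching.
Color : Set
Color = Fin 5

pattern 0c = zero

-- The colour of an edge, and the two other colours at one of its ends.
record State : Set where
  constructor ⟨_∣_,_⟩
  field
    own left right : Color

open State

Free : Color → Color → Set
Free x y = x ≡ y → x ≡ 0c

Apart : State → Set
Apart ⟨ c ∣ x , y ⟩ = c ≢ x × c ≢ y × x ≢ y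

infix 4 _⋈_

-- s and t can be the states of one edge at its two ends.
record _⋈_ (s t : State) : Set where
  constructor meet
  field
    same : own s ≡ own t
    free : (Free (left s) (left t) × Free (left s) (right t)) ×
           (Free (right s) (left t) × Free (right s) (right t))

-- f can be the colour of another edge at the end opposite to s.
Follows : State → Color → Set
Follows s f = own s ≢ f × Free (left s) f × Free (right s) f

-- Between an edge with state s at its near end and an edge with state t at its
-- far end, k vertices of degree 2 can be inserted and coloured.
data Extends : ℕ → State → State → Set where
  meets : ∀ {s t} → s ⋈ t → Extends zero s t
  via   : ∀ {k s t f g} → Follows s f → Follows s g → f ≢ g →
          Extends k ⟨ f ∣ own s , g ⟩ t → Extends (suc k) s t

-- A state with a 0 among the other two colours is less restrictive than one
-- with that 0 replaced, so only these states need to be checked.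
Normal : State → Set
Normal s@(⟨ c ∣ x , y ⟩) = x ≢ 0c × x Fin.< y × Apart s

Covers : State → Color → Set
Covers s x = x ≡ 0c ⊎ x ≡ left s ⊎ x ≡ right s

-- At an edge of state s, a vertex can be attached that lies on a cycle with k
-- further vertices, all of degree 2.
Closable : ℕ → Set
Closable k = ∀ s → Normal s → ∃ λ e → ∃₂ λ f g →
  Apart ⟨ f ∣ g , e ⟩ × s ⋈ ⟨ e ∣ f , g ⟩ × Extends k ⟨ f ∣ g , e ⟩ ⟨ g ∣ f , e ⟩

follows-⋈ : ∀ {s f g} → Follows s f → Follows s g → s ⋈ ⟨ own s ∣ f , g ⟩
follows-⋈ (_ , lf , rf) (_ , lg , rg) = meet refl ((lf , lg) , rf , rg)

follows-apart : ∀ {s f g} → Follows s f → Follows s g → f ≢ g → Apart ⟨ own s ∣ f , g ⟩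
follows-apart (c≢f , _) (c≢g , _) f≢g = c≢f , c≢g , f≢g

private
  free? : ∀ x y → Dec (Free x y)
  free? x y = x Fin.≟ y →-dec x Fin.≟ 0c

  apart? : ∀ s → Dec (Apart s)
  apart? ⟨ c ∣ x , y ⟩ = ¬? (c Fin.≟ x) ×-dec ¬? (c Fin.≟ y) ×-dec ¬? (x Fin.≟ y)

  infix 4 _⋈?_

  _⋈?_ : ∀ s t → Dec (s ⋈ t)
  s ⋈? t = map′ (uncurry meet) (λ { (meet same free) → same , free })
    (own s Fin.≟ own t ×-dec
      (free? (left s) (left t) ×-dec free? (left s) (right t)) ×-dec
      (free? (right s) (left t) ×-dec free? (right s) (right t)))

  follows? : ∀ s f → Dec (Follows s f)
  follows? s f = ¬? (own s Fin.≟ f) ×-dec free? (left s) f ×-dec free? (right s) f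

  extends? : ∀ k s t → Dec (Extends k s t)
  extends? zero    s t = map′ meets (λ { (meets s⋈t) → s⋈t }) (s ⋈? t)
  extends? (suc k) s t = map′
    (λ { (f , ok-f , g , ok-g , f≢g , rest) → via ok-f ok-g f≢g rest })
    (λ { (via ok-f ok-g f≢g rest) → _ , ok-f , _ , ok-g , f≢g , rest })
    (Fin.any? λ f → follows? s f ×-dec Fin.any? λ g → follows? s g ×-dec
      ¬? (f Fin.≟ g) ×-dec extends? k ⟨ f ∣ own s , g ⟩ t)

  normal? : ∀ s → Dec (Normal s)
  normal? s@(⟨ c ∣ x , y ⟩) = ¬? (x Fin.≟ 0c) ×-dec (x Fin.<? y) ×-dec apart? s

  covers? : ∀ s x → Dec (Covers s x)
  covers? s x = (x Fin.≟ 0c) ⊎-dec (x Fin.≟ left s) ⊎-dec (x Fin.≟ right s)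

  allNormal? : ∀ {P : State → Set} → (∀ s → Dec (P s)) → Dec (∀ s → Normal s → P s)
  allNormal? P? = map′ (λ { h ⟨ c ∣ x , y ⟩ → h x y c }) (λ h x y c → h ⟨ c ∣ x , y ⟩)
    (Fin.all? λ x → Fin.all? λ y → Fin.all? λ c → normal? ⟨ c ∣ x , y ⟩ →-dec P? ⟨ c ∣ x , y ⟩)

  closable? : ∀ k → Dec (Closable k)
  closable? k = allNormal? λ s → Fin.any? λ e → Fin.any? λ f → Fin.any? λ g →
    apart? ⟨ f ∣ g , e ⟩ ×-dec (s ⋈? ⟨ e ∣ f , g ⟩) ×-dec extends? k ⟨ f ∣ g , e ⟩ ⟨ g ∣ f , e ⟩

-- These are opaque because with-abstraction would normalise the searches.
opaque
  normalise : ∀ c x y → Apart ⟨ c ∣ x , y ⟩ → ∃₂ λ l r →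
    let s = ⟨ c ∣ l , r ⟩ in Normal s × Covers s x × Covers s y
  normalise = from-yes (Fin.all? λ c → Fin.all? λ x → Fin.all? λ y → apart? ⟨ c ∣ x , y ⟩ →-dec
    (Fin.any? λ l → Fin.any? λ r →
      let s = ⟨ c ∣ l , r ⟩ in normal? s ×-dec covers? s x ×-dec covers? s y))

  -- Three inserted vertices leave enough freedom to reach every far state with a 0 among its other
  -- two colours. The 0 may stand on either side, because a `State` orders them.
  extends-three : ∀ s → Normal s → ∀ c x → Apart ⟨ c ∣ 0c , x ⟩ →
    Extends 3 s ⟨ c ∣ 0c , x ⟩ × Extends 3 s ⟨ c ∣ x , 0c ⟩
  extends-three = from-yes (allNormal? λ s → Fin.all? λ c → Fin.all? λ x → apart? ⟨ c ∣ 0c , x ⟩ →-dec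
    (extends? 3 s ⟨ c ∣ 0c , x ⟩ ×-dec extends? 3 s ⟨ c ∣ x , 0c ⟩))

  -- Finds the palette of a vertex at which threads of one and two vertices meet, with g for its
  -- third port. `chain` leaves that port dangling; `spider` has its long thread there and needs the
  -- 0 for `extends-three`.
  extends-one-two : ∀ s → Normal s → ∀ t → Normal t → ∃ λ e → ∃₂ λ f g →
    (e ≡ 0c ⊎ f ≡ 0c) × Apart ⟨ e ∣ f , g ⟩ × Extends 1 s ⟨ e ∣ f , g ⟩ × Extends 2 t ⟨ f ∣ e , g ⟩
  extends-one-two = from-yes (allNormal? λ s → allNormal? λ t →
    (Fin.any? λ e → Fin.any? λ f → Fin.any? λ g →
      (e Fin.≟ 0c ⊎-dec f Fin.≟ 0c) ×-dec apart? ⟨ e ∣ f , g ⟩ ×-dec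
      extends? 1 s ⟨ e ∣ f , g ⟩ ×-dec extends? 2 t ⟨ f ∣ e , g ⟩))

  close₂ : Closable 2
  close₂ = from-yes (closable? 2)

  close₃ : Closable 3
  close₃ = from-yes (closable? 3)

-- The three colours at a vertex

Palette : Set
Palette = Fin 3 → Color

Injective : Palette → Set
Injective t = ∀ i j → t i ≡ t j → i ≡ j

-- `Covers` lets the other colours be 0 instead of those in s, so s may be stricter than the palette
-- itself. This allows `view` to return a normal state.
record Facing (t : Palette) (i : Fin 3) (s : State) : Set where
  constructor facing
  field
    colour : t i ≡ own s
    others : ∀ p → p ≢ i → Covers s (t p)

record Compatible (t : Palette) (i : Fin 3) (t′ : Palette) (j : Fin 3) : Set where
  constructor compatible
  field
    agree    : t i ≡ t′ j
    separate : ∀ p q → p ≢ i → q ≢ j → Free (t p) (t′ q)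

free-sym : ∀ {x y} → Free x y → Free y x
free-sym free y≡x = trans y≡x (free (sym y≡x))

⋈-sym : ∀ {s t} → s ⋈ t → t ⋈ s
⋈-sym (meet same ((ll , lr) , rl , rr)) = meet (sym same)
  ((free-sym ll , free-sym rl) , free-sym lr , free-sym rr)

compatible-sym : ∀ {t i t′ j} → Compatible t i t′ j → Compatible t′ j t i
compatible-sym (compatible a s) = compatible (sym a) λ p q p≢j q≢i → free-sym (s q p q≢i p≢j)

-- A covered colour is either 0, which is free against everything, or one of the colours that
-- `s ⋈ s′` compares.
facing-compatible : ∀ {t i t′ j s s′} → Facing t i s → Facing t′ j s′ → s ⋈ s′ → Compatible t i t′ j
facing-compatible {t} {i} {t′} {j} {s} {s′} (facing c o) (facing c′ o′) (meet c≡c′ ((xx , xy) , yx , yy)) =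
  compatible (trans c (trans c≡c′ (sym c′))) λ p q p≢i q≢j → separate (o p p≢i) (o′ q q≢j)
  where
  free : ∀ {x y x′ y′} → x ≡ x′ → y ≡ y′ → Free x′ y′ → Free x y
  free refl refl f = f
  separate : ∀ {x y} → Covers s x → Covers s′ y → Free x y
  separate (inj₁ x≡0) _ _ = x≡0
  separate (inj₂ _) (inj₁ y≡0) x≡y = trans x≡y y≡0
  separate (inj₂ (inj₁ p)) (inj₂ (inj₁ q)) = free p q xx
  separate (inj₂ (inj₁ p)) (inj₂ (inj₂ q)) = free p q xy
  separate (inj₂ (inj₂ p)) (inj₂ (inj₁ q)) = free p q yx
  separate (inj₂ (inj₂ p)) (inj₂ (inj₂ q)) = free p q yy

opaque
  third-unique : ∀ (i j p q : Fin 3) → i ≢ j → p ≢ i → p ≢ j → q ≢ i → q ≢ j → p ≡ q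
  third-unique = from-yes (
    Fin.all? {n = 3} λ i → Fin.all? {n = 3} λ j → Fin.all? {n = 3} λ p → Fin.all? {n = 3} λ q →
    ¬? (i Fin.≟ j) →-dec ¬? (p Fin.≟ i) →-dec ¬? (p Fin.≟ j) →-dec
    ¬? (q Fin.≟ i) →-dec ¬? (q Fin.≟ j) →-dec p Fin.≟ q)

other-two : ∀ (i : Fin 3) → ∃₂ λ j k → i ≢ j × i ≢ k × j ≢ k
other-two zero             = suc zero , suc (suc zero) , (λ ()) , (λ ()) , λ ()
other-two (suc zero)       = zero , suc (suc zero) , (λ ()) , (λ ()) , λ ()
other-two (suc (suc zero)) = zero , suc zero , (λ ()) , (λ ()) , λ ()

opaque
  third-port : ∀ (i j : Fin 3) → ∃ λ k → k ≢ i × k ≢ j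
  third-port = from-yes (Fin.all? {n = 3} λ i → Fin.all? {n = 3} λ j → Fin.any? {n = 3} λ k →
    ¬? (k Fin.≟ i) ×-dec ¬? (k Fin.≟ j))

data Position (i j p : Fin 3) : Set where
  first  : p ≡ i → Position i j p
  second : p ≡ j → Position i j p
  third  : p ≢ i → p ≢ j → Position i j p

position : ∀ i j p → Position i j p
position i j p with p Fin.≟ i | p Fin.≟ j
... | yes p≡i | _       = first p≡i
... | no _    | yes p≡j = second p≡j
... | no p≢i  | no p≢j  = third p≢i p≢j

module _ {i j : Fin 3} (i≢j : i ≢ j) (e f g : Color) where

  palette : Palette
  palette p with position i j p
  ... | first _   = e
  ... | second _  = f
  ... | third _ _ = g

  private
    at-first : palette i ≡ e
    at-first with position i j i
    ... | first _      = refl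
    ... | second i≡j   = ⊥-elim (i≢j i≡j)
    ... | third i≢i _  = ⊥-elim (i≢i refl)

    at-second : palette j ≡ f
    at-second with position i j j
    ... | first j≡i    = ⊥-elim (i≢j (sym j≡i))
    ... | second _     = refl
    ... | third _ j≢j  = ⊥-elim (j≢j refl)

    at-third : ∀ {p} → p ≢ i → p ≢ j → palette p ≡ g
    at-third {p} p≢i p≢j with position i j p
    ... | first p≡i   = ⊥-elim (p≢i p≡i)
    ... | second p≡j  = ⊥-elim (p≢j p≡j)
    ... | third _ _   = refl

  facing-first : Facing palette i ⟨ e ∣ f , g ⟩
  facing-first = facing at-first λ p p≢i → inj₂ (others p p≢i)
    where
    others : ∀ p → p ≢ i → palette p ≡ f ⊎ palette p ≡ g
    others p p≢i with position i j p
    ... | first p≡i  = ⊥-elim (p≢i p≡i)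
    ... | second _   = inj₁ refl
    ... | third _ _  = inj₂ refl

  facing-second : Facing palette j ⟨ f ∣ e , g ⟩
  facing-second = facing at-second λ p p≢j → inj₂ (others p p≢j)
    where
    others : ∀ p → p ≢ j → palette p ≡ e ⊎ palette p ≡ g
    others p p≢j with position i j p
    ... | first _     = inj₁ refl
    ... | second p≡j  = ⊥-elim (p≢j p≡j)
    ... | third _ _   = inj₂ refl

  facing-third : ∀ {k} → k ≢ i → k ≢ j → Facing palette k ⟨ g ∣ e , f ⟩
  facing-third {k} k≢i k≢j = facing (at-third k≢i k≢j) λ p p≢k → inj₂ (others p p≢k)
    where
    others : ∀ p → p ≢ k → palette p ≡ e ⊎ palette p ≡ f
    others p p≢k with position i j p
    ... | first _        = inj₁ refl
    ... | second _       = inj₂ refl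
    ... | third p≢i p≢j  = ⊥-elim (p≢k (third-unique i j p k i≢j p≢i p≢j k≢i k≢j))

  palette-injective : Apart ⟨ e ∣ f , g ⟩ → Injective palette
  palette-injective (e≢f , e≢g , f≢g) p q eq with position i j p | position i j q
  ... | first refl      | first refl      = refl
  ... | first _         | second _        = ⊥-elim (e≢f eq)
  ... | first _         | third _ _       = ⊥-elim (e≢g eq)
  ... | second _        | first _         = ⊥-elim (e≢f (sym eq))
  ... | second refl     | second refl     = refl
  ... | second _        | third _ _       = ⊥-elim (f≢g eq)
  ... | third _ _       | first _         = ⊥-elim (e≢g (sym eq))
  ... | third _ _       | second _        = ⊥-elim (f≢g (sym eq))
  ... | third p≢i p≢j   | third q≢i q≢j   = third-unique i j p q i≢j p≢i p≢j q≢i q≢j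

view : ∀ {t} → Injective t → ∀ i → ∃ λ s → Normal s × Facing t i s
view {t} inj i with other-two i
... | j , k , i≢j , i≢k , j≢k
  with normalise (t i) (t j) (t k) (i≢j ∘ inj i j , i≢k ∘ inj i k , j≢k ∘ inj j k)
... | l , r , normal , cj , ck = s , normal , facing refl covered
  where
  s = ⟨ t i ∣ l , r ⟩
  covered : ∀ p → p ≢ i → Covers s (t p)
  covered p p≢i with p Fin.≟ j
  ... | yes refl = cj
  ... | no p≢j   = subst (Covers s ∘ t) (third-unique i j k p i≢j (i≢k ∘ sym) (j≢k ∘ sym) p≢i p≢j) ck

-- Ports and colourings

-- Ports leading to nothing are dangling.
record Ports {n} (G : Graph n) : Set where
  field
    port     : Fin n → Fin 3 → Maybe (Fin n)
    port-adj : ∀ {v i w} → port v i ≡ just w → adj G v w ≡ true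
    port-to  : ∀ {v w} → adj G v w ≡ true → ∃ λ i → port v i ≡ just w
    port-inj : ∀ {v i j w} → port v i ≡ just w → port v j ≡ just w → i ≡ j

-- The elements of p fill the first slots; the slots left over become the dangling ports of vertices
-- of degree below 3.
enumerate : ∀ {n k} (p : Subset n) → ∣ p ∣ ≤ k → ∃ λ (f : Fin k → Maybe (Fin n)) →
  (∀ i {x} → f i ≡ just x → Vec.lookup p x ≡ inside) ×
  (∀ {x} → Vec.lookup p x ≡ inside → ∃ λ i → f i ≡ just x) ×
  (∀ i j {x} → f i ≡ just x → f j ≡ just x → i ≡ j)
enumerate Vec.[] _ = (λ _ → nothing) , (λ _ ()) , (λ {x} → λ { _ → ⊥-elim (Fin.¬Fin0 x) }) , λ _ _ ()
enumerate {k = suc k} (inside Vec.∷ p) (s≤s p≤k) with enumerate p p≤k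
... | f , sound , complete , inj = f′ , sound′ , complete′ , inj′
  where
  f′ : Fin (suc k) → Maybe (Fin _)
  f′ zero    = just zero
  f′ (suc i) = Maybe.map suc (f i)
  sound′ : ∀ i {x} → f′ i ≡ just x → Vec.lookup (inside Vec.∷ p) x ≡ inside
  sound′ zero refl = refl
  sound′ (suc i) eq with f i in fi
  sound′ (suc i) refl | just _ = sound i fi
  complete′ : ∀ {x} → Vec.lookup (inside Vec.∷ p) x ≡ inside → ∃ λ i → f′ i ≡ just x
  complete′ {zero} _ = zero , refl
  complete′ {suc x} x∈p with complete x∈p
  ... | i , fi = suc i , cong (Maybe.map suc) fi
  inj′ : ∀ i j {x} → f′ i ≡ just x → f′ j ≡ just x → i ≡ j
  inj′ zero zero _ _ = refl
  inj′ zero (suc j) refl eq with f j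
  inj′ zero (suc j) refl () | just _
  inj′ zero (suc j) refl () | nothing
  inj′ (suc i) zero eq refl with f i
  inj′ (suc i) zero () refl | just _
  inj′ (suc i) zero () refl | nothing
  inj′ (suc i) (suc j) eq eq′ with f i in fi | f j in fj
  inj′ (suc i) (suc j) refl refl | just _ | just _ = cong suc (inj i j fi fj)
enumerate {n = suc n} {k = k} (outside Vec.∷ p) p≤k with enumerate p p≤k
... | f , sound , complete , inj = f′ , sound′ , complete′ , inj′
  where
  f′ : Fin k → Maybe (Fin (suc n))
  f′ i = Maybe.map suc (f i)
  sound′ : ∀ i {x} → f′ i ≡ just x → Vec.lookup (outside Vec.∷ p) x ≡ inside
  sound′ i eq with f i in fi
  sound′ i refl | just _ = sound i fi
  complete′ : ∀ {x} → Vec.lookup (outside Vec.∷ p) x ≡ inside → ∃ λ i → f′ i ≡ just x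
  complete′ {suc x} x∈p with complete x∈p
  ... | i , fi = i , cong (Maybe.map suc) fi
  inj′ : ∀ i j {x} → f′ i ≡ just x → f′ j ≡ just x → i ≡ j
  inj′ i j eq eq′ with f i in fi | f j in fj
  inj′ i j refl refl | just _ | just _ = inj i j fi fj

portsOf : ∀ {n} (G : Graph n) → (∀ v → degree G v ≤ 3) → Ports G
portsOf G deg≤3 = record
  { port     = λ v → proj₁ (e v)
  ; port-adj = λ {v} {i} {w} eq → trans (sym (Vec.lookup∘tabulate (adj G v) w)) (proj₁ (proj₂ (e v)) i eq)
  ; port-to  = λ {v} {w} eq → proj₁ (proj₂ (proj₂ (e v))) (trans (Vec.lookup∘tabulate (adj G v) w) eq)
  ; port-inj = λ {v} {i} {j} → proj₂ (proj₂ (proj₂ (e v))) i j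
  }
  where
  e = λ v → enumerate (neighbours G v) (deg≤3 v)

witness : ∀ {A : Set} (A? : Dec A) → does A? ≡ true → A
witness (yes a) _ = a

-- Reinserting vertices into a coloured set

module Extension {n} (G : Graph n) (ports : Ports G) where
  open Ports ports

  private
    V = Fin n

  Adj : V → V → Set
  Adj v w = adj G v w ≡ true

  adj-sym : ∀ {v w} → Adj v w → Adj w v
  adj-sym {v} {w} vw = trans (Graph.sym G w v) vw

  adj-irrefl : ∀ {v w} → Adj v w → v ≢ w
  adj-irrefl {v} vv refl with () ← trans (sym vv) (Graph.irrefl G v)

  ports-differ : ∀ {v x y i j} → x ≢ y → port v i ≡ just x → port v j ≡ just y → i ≢ j
  ports-differ x≢y toX toY refl = x≢y (Maybe.just-injective (trans (sym toX) toY))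

  Link : V → Fin 3 → V → Fin 3 → Set
  Link v i w j = port v i ≡ just w × port w j ≡ just v

  link-sym : ∀ {v i w j} → Link v i w j → Link w j v i
  link-sym = swap

  -- Palettes are injective at all vertices, but an edge is controlled only if both ends satisfy P.
  -- An edge leaving P thus acts as a dangling port with a colour of its own.
  record Valid (P : Pred V _) (c : V → Palette) : Set where
    field
      injective : ∀ v → Injective (c v)
      links     : ∀ {v i w j} → P v → P w → Link v i w j → Compatible (c v) i (c w) j

  open Valid

  Colourable : Subset n → Set
  Colourable S = ∃ (Valid (_∈ S))

  Without : Subset n → List V → Pred V _
  Without S R x = x ∈ S × x ∉ₗ R

  -- The induction hypothesis applies to S with R taken out: r lies in both, so the inclusion is
  -- proper.
  erase : ∀ {S R r} → r ∈ S → r ∈ₗ R → (∀ T → T ⊂ S → Colourable T) → ∃ (Valid (Without S R))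
  erase {S} {R} {r} r∈S r∈R smaller with smaller T (T⊆S , r , r∈S , λ r∈T → proj₂ (T-sound r∈T) r∈R)
    where
    open DecMembership Fin._≟_ using () renaming (_∈?_ to _∈ₗ?_)
    T : Subset n
    T = Vec.tabulate λ x → does (x ∈? S ×-dec ¬? (x ∈ₗ? R))
    T-sound : ∀ {x} → x ∈ T → Without S R x
    T-sound {x} x∈T =
      witness (x ∈? S ×-dec ¬? (x ∈ₗ? R)) (trans (sym (Vec.lookup∘tabulate _ x)) (Vec.[]=⇒lookup x∈T))
    T⊆S : T ⊆ S
    T⊆S = proj₁ ∘ T-sound
  ... | c , valid = c , record
    { injective = injective valid
    ; links     = λ v∈ w∈ → links valid (T-complete v∈) (T-complete w∈)
    }
    where
    open DecMembership Fin._≟_ using () renaming (_∈?_ to _∈ₗ?_)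
    T-complete : ∀ {x} → Without S R x → x ∈ Vec.tabulate λ x → does (x ∈? S ×-dec ¬? (x ∈ₗ? R))
    T-complete {x} x∈ = Vec.lookup⇒[]= x _
      (trans (Vec.lookup∘tabulate _ x) (dec-true (x ∈? S ×-dec ¬? (x ∈ₗ? R)) x∈))

  module _ {S : Subset n} where

    recolour : ∀ {R a c t} → Valid (Without S (a ∷ R)) c → Injective t →
      (∀ {p x q} → Without S (a ∷ R) x → Link a p x q → Compatible t p (c x) q) →
      ∃ λ c′ → Valid (Without S R) c′ × (∀ {x} → x ≢ a → c′ x ≡ c x) × c′ a ≡ t
    recolour {R} {a} {c} {t} valid inj fits = c′ , valid′ , other , at-a
      where
      c′ : V → Palette
      c′ x with x Fin.≟ a
      ... | yes _ = t
      ... | no _  = c x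

      other : ∀ {x} → x ≢ a → c′ x ≡ c x
      other {x} x≢a with x Fin.≟ a
      ... | yes x≡a = ⊥-elim (x≢a x≡a)
      ... | no _    = refl

      at-a : c′ a ≡ t
      at-a with a Fin.≟ a
      ... | yes _   = refl
      ... | no a≢a  = ⊥-elim (a≢a refl)

      keep : ∀ {x} → Without S R x → x ≢ a → Without S (a ∷ R) x
      keep (x∈S , x∉R) x≢a = x∈S , λ { (here x≡a) → x≢a x≡a ; (there x∈R) → x∉R x∈R }

      valid′ : Valid (Without S R) c′
      valid′ .injective v with v Fin.≟ a
      ... | yes _ = inj
      ... | no _  = injective valid v
      valid′ .links {v} {i} {w} {j} v∈ w∈ link with v Fin.≟ a | w Fin.≟ a
      ... | yes refl | yes refl = ⊥-elim (adj-irrefl (port-adj (proj₁ link)) refl)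
      ... | yes refl | no w≢a   = fits (keep w∈ w≢a) link
      ... | no v≢a   | yes refl = compatible-sym (fits (keep v∈ v≢a) (link-sym link))
      ... | no v≢a   | no w≢a   = links valid (keep v∈ v≢a) (keep w∈ w≢a) link

    -- If port i of u leads to a vertex in S outside R, then u may show the state t there.
    Fits : List V → (V → Palette) → V → Fin 3 → State → Set
    Fits R c u i t = ∀ {x q} → Without S R x → Link u i x q → ∃ λ s → Facing (c x) q s × s ⋈ t

    Sees : (V → Palette) → V → V → State → Set
    Sees c v x s = ∀ {i q} → Link v i x q → Facing (c x) q s

    sees-frame : ∀ {c c′ v x s} → c′ x ≡ c x → Sees c v x s → Sees c′ v x s
    sees-frame {s = s} eq sees {q = q} link = subst (λ t → Facing t q s) (sym eq) (sees link)

    sees-palette : ∀ {c v x q t s} → port x q ≡ just v → c x ≡ t → Facing t q s → Sees c v x s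
    sees-palette {s = s} toV refl f (_ , toV′) with refl ← port-inj toV toV′ = f

    -- If no port of x leads to v, then `Sees` is vacuous and any normal state will do, so v and x
    -- need not be known to be adjacent.
    sight : ∀ {P c} → Valid P c → ∀ v x → ∃ λ s → Normal s × Sees c v x s
    sight {c = c} valid v x with Fin.any? (λ q → Maybe.≡-dec Fin._≟_ (port x q) (just v))
    ... | no none        = let s , normal , _ = view (injective valid x) zero in
                           s , normal , λ link → ⊥-elim (none (_ , proj₂ link))
    ... | yes (q , toV)  = let s , normal , f = view (injective valid x) q in
                           s , normal , sees-palette {c = c} toV refl f

    fits-sees : ∀ {R c u i x s t} → port u i ≡ just x → Sees c u x s → s ⋈ t → Fits R c u i t
    fits-sees toX sees s⋈t _ link with refl ← Maybe.just-injective (trans (sym toX) (proj₁ link)) =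
      _ , sees link , s⋈t

    fits-absent : ∀ {R c u i x t} → port u i ≡ just x → x ∈ₗ R → Fits R c u i t
    fits-absent toX x∈R (_ , x∉R) link with refl ← Maybe.just-injective (trans (sym toX) (proj₁ link)) =
      ⊥-elim (x∉R x∈R)

    -- The general reinsertion step, with colours e, f, g at ports i, j and the third port. Every
    -- reduction rests on it, directly or through `join₂`.
    join : ∀ {R u c e f g i j} → Valid (Without S (u ∷ R)) c → (i≢j : i ≢ j) → Apart ⟨ e ∣ f , g ⟩ →
      Fits (u ∷ R) c u i ⟨ e ∣ f , g ⟩ → Fits (u ∷ R) c u j ⟨ f ∣ e , g ⟩ →
      (∀ {k} → k ≢ i → k ≢ j → Fits (u ∷ R) c u k ⟨ g ∣ e , f ⟩) →
      ∃ λ c′ → Valid (Without S R) c′ × (∀ {x} → x ≢ u → c′ x ≡ c x) × c′ u ≡ palette i≢j e f g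
    join {R} {u} {c} {e} {f} {g} {i} {j} valid i≢j apart fit₁ fit₂ fit₃ =
      recolour valid (palette-injective i≢j e f g apart) compat
      where
      fit : ∀ {p x q s′} → Without S (u ∷ R) x → Link u p x q →
        Facing (palette i≢j e f g) p s′ → Fits (u ∷ R) c u p s′ → Compatible (palette i≢j e f g) p (c x) q
      fit x∈ link facing′ fits with s , f , s⋈ ← fits x∈ link =
        facing-compatible facing′ f (⋈-sym s⋈)
      compat : ∀ {p x q} → Without S (u ∷ R) x → Link u p x q → Compatible (palette i≢j e f g) p (c x) q
      compat {p} x∈ link with position i j p
      ... | first refl       = fit x∈ link (facing-first i≢j e f g) fit₁
      ... | second refl      = fit x∈ link (facing-second i≢j e f g) fit₂
      ... | third p≢i p≢j    = fit x∈ link (facing-third i≢j e f g p≢i p≢j) (fit₃ p≢i p≢j)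

    -- In the subgraph induced by S, the neighbours of a are x and y.
    record Two (a x y : V) : Set where
      constructor two
      field
        member   : a ∈ S
        members  : x ∈ S × y ∈ S
        distinct : x ≢ y
        adj₁     : Adj a x
        adj₂     : Adj a y
        cover    : ∀ {z} → z ∈ S → Adj a z → z ≡ x ⊎ z ≡ y

    open Two

    record Three (u x y z : V) : Set where
      constructor three
      field
        member   : u ∈ S
        members  : x ∈ S × y ∈ S × z ∈ S
        distinct : x ≢ y × x ≢ z × y ≢ z
        adjacent : Adj u x × Adj u y × Adj u z
        cover    : ∀ {w} → w ∈ S → Adj u w → w ≡ x ⊎ w ≡ y ⊎ w ≡ z

    three-not-two : ∀ {u x y z v w} → Three u x y z → ¬ Two u v w
    three-not-two (three _ (x∈S , y∈S , z∈S) (x≢y , x≢z , y≢z) (ux , uy , uz) _) u-two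
      with cover u-two x∈S ux | cover u-two y∈S uy | cover u-two z∈S uz
    ... | inj₁ refl | inj₁ refl | _         = x≢y refl
    ... | inj₁ refl | inj₂ refl | inj₁ refl = x≢z refl
    ... | inj₁ refl | inj₂ refl | inj₂ refl = y≢z refl
    ... | inj₂ refl | inj₁ refl | inj₁ refl = y≢z refl
    ... | inj₂ refl | inj₁ refl | inj₂ refl = x≢z refl
    ... | inj₂ refl | inj₂ refl | _         = x≢y refl

    flip : ∀ {a x y} → Two a x y → Two a y x
    flip (two m ms d p q cov) = two m (swap ms) (d ∘ sym) q p λ z∈S az → Sum.swap (cov z∈S az)

    join₂ : ∀ {R a x y c e f g} → Two a x y → Valid (Without S (a ∷ R)) c → Apart ⟨ e ∣ f , g ⟩ →
      (∀ {i} → port a i ≡ just x → Fits (a ∷ R) c a i ⟨ e ∣ f , g ⟩) →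
      (∀ {i} → port a i ≡ just y → Fits (a ∷ R) c a i ⟨ f ∣ e , g ⟩) →
      ∃ λ c′ → Valid (Without S R) c′ × (∀ {x} → x ≢ a → c′ x ≡ c x) × Sees c′ y a ⟨ f ∣ e , g ⟩
    join₂ {a = a} {c = c} {e} {f} {g} (two _ _ x≢y ax ay cov) valid apart fit₁ fit₂
      with i , toX ← port-to ax
      with j , toY ← port-to ay
      with c′ , valid′ , frame , at-a ←
        join valid (ports-differ x≢y toX toY) apart (fit₁ toX) (fit₂ toY) (λ k≢i k≢j (x∈S , _) link →
          -- The neighbours of a in S sit at ports i and j, so the third port leads to no vertex of
          -- S and g meets no condition.
          case cov x∈S (port-adj (proj₁ link)) of λ
            { (inj₁ refl) → ⊥-elim (k≢i (port-inj (proj₁ link) toX))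
            ; (inj₂ refl) → ⊥-elim (k≢j (port-inj (proj₁ link) toY)) })
      = c′ , valid′ , frame , sees-palette {c = c′} toY at-a (facing-second (ports-differ x≢y toX toY) e f g)

    ∈-last : ∀ {d} (xs : List V) → d ∈ₗ xs ++ d ∷ []
    ∈-last []       = here refl
    ∈-last (_ ∷ xs) = there (∈-last xs)

    -- A thread from w through the vertices of xs, of which a is the first and
    -- l the last, to b. For empty xs these are a = b and l = w.
    data Thread : (w a : V) (xs : List V) (l b : V) → Set where
      []  : ∀ {w b} → Thread w b [] w b
      _∷_ : ∀ {w a a′ xs l b} → Two a w a′ → Thread a a′ xs l b → Thread w a (a ∷ xs) l b

    thread-head : ∀ {w a xs l b R} → Thread w a xs l b → b ∈ₗ R → a ∈ₗ xs ++ R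
    thread-head []       b∈R = b∈R
    thread-head (_ ∷ _)  b∈R = here refl

    -- The vertices of the thread are reinserted in order from w, each using up one `via`. The next
    -- vertex is always still removed, so nothing presses from ahead; k insertions remain for what
    -- follows.
    leg : ∀ k {w a xs l b R c s t} → Thread w a xs l b → b ∈ₗ R → Valid (Without S (xs ++ R)) c →
      Sees c a w s → Extends (length xs + k) s t →
      ∃ λ c′ → Valid (Without S R) c′ × (∀ {x} → x ∉ₗ xs → c′ x ≡ c x) × ∃ λ s′ → Sees c′ b l s′ × Extends k s′ t
    leg k [] b∈R valid sees extends = _ , valid , (λ _ → refl) , _ , sees , extends
    leg k {c = c} (a-two ∷ thread) b∈R valid sees (via ok-f ok-g f≢g extends)
      with c₁ , valid₁ , frame₁ , sees₁ ← join₂ a-two valid (follows-apart ok-f ok-g f≢g)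
             (λ toW → fits-sees {c = c} toW sees (follows-⋈ ok-f ok-g))
             (λ toA′ → fits-absent {c = c} toA′ (there (thread-head thread b∈R)))
      with c₂ , valid₂ , frame₂ , s′ , sees₂ , extends′ ← leg k thread b∈R valid₁ sees₁ extends
      = c₂ , valid₂ , (λ x∉ → trans (frame₂ (x∉ ∘ there)) (frame₁ (x∉ ∘ here))) , s′ , sees₂ , extends′

    glance : ∀ {P c} → Valid P c → ∀ u k →
      ∃ λ s → Normal s × (∀ {x q} → Link u k x q → Facing (c x) q s)
    glance valid u k with port u k in toX
    ... | nothing with s , normal , _ ← view (injective valid u) zero = s , normal , λ { (() , _) }
    ... | just x with s , normal , sees ← sight valid u x = s , normal , λ { (refl , back) → sees (toX , back) }

    entrance : ∀ u w → ∃ λ i → ∀ {x p} → x ≡ w → port u p ≡ just x → p ≡ i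
    entrance u w with Fin.any? (λ q → Maybe.≡-dec Fin._≟_ (port u q) (just w))
    ... | yes (i , toW) = i , λ { refl toX → port-inj toX toW }
    ... | no none       = zero , λ { {p = p} refl toX → ⊥-elim (none (p , toX)) }

    -- Reducible configurations

    module Reductions (smaller : ∀ T → T ⊂ S → Colourable T) where

      restored : ∀ {c} → Valid (Without S []) c → Colourable S
      restored valid = _ , record
        { injective = injective valid
        ; links     = λ v∈S w∈S → links valid (v∈S , λ ()) (w∈S , λ ()) }

      -- u may have a third neighbour, whose state decides the palette of u. The vertices of xs are
      -- then coloured around the cycle from a, and d closes it.
      cycle : ∀ {u a xs l d} → u ∈ S → Thread u a xs l d → Two d l u → u ∉ₗ xs → a ≢ d → Adj u a →
        Closable (length xs + 1) →
        Colourable S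
      cycle {u} {a} {xs} {l} {d} u∈S thread d-two u∉xs a≢d ua closing
        with i , toA ← port-to ua
        with j , toD ← port-to (adj-sym (adj₂ d-two))
        with k , k≢i , k≢j ← third-port i j
        with c , valid ← erase {R = u ∷ xs ++ d ∷ []} u∈S (here refl) smaller
        with s , normal , look ← glance valid u k
        with e , f , g , apart , s⋈ , extends ← closing s normal
        with i≢j ← ports-differ a≢d toA toD
        with c₁ , valid₁ , frame₁ , at-u ← join valid i≢j apart
               (fits-absent {c = c} toA (there (thread-head thread (here refl))))
               (fits-absent {c = c} toD (there (∈-last xs)))
               (λ {k′} k′≢i k′≢j _ link →
                 s , look (subst (λ p → Link u p _ _) (third-unique i j k′ k i≢j k′≢i k′≢j k≢i k≢j) link) , s⋈)
        -- One insertion is held back for d, which has to agree with l on one side and with u on the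
        -- other.
        with c₂ , valid₂ , frame₂ , s′ , sees₂ , via ok-f ok-g f≢g (meets ⋈u) ← leg 1 thread (here refl) valid₁
               (sees-palette {c = c₁} toA at-u (facing-first i≢j f g e)) extends
        with c₃ , valid₃ , _ ← join₂ d-two valid₂ (follows-apart ok-f ok-g f≢g)
               (λ toL → fits-sees {c = c₂} toL sees₂ (follows-⋈ ok-f ok-g))
               (λ toU → fits-sees {c = c₂} toU
                 (sees-palette {c = c₂} toD (trans (frame₂ u∉xs) at-u) (facing-second i≢j f g e)) (⋈-sym ⋈u))
        = restored valid₃

      triangle : ∀ {u a d} → u ∈ S → Two a u d → Two d a u → Colourable S
      triangle u∈S a-two d-two = cycle u∈S (a-two ∷ []) d-two
        (λ { (here u≡a) → adj-irrefl (adj₁ a-two) (sym u≡a) })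
        (adj-irrefl (adj₂ a-two)) (adj-sym (adj₁ a-two)) close₂

      square : ∀ {u a b d} → u ∈ S → Two a u b → Two b a d → Two d b u → Colourable S
      square u∈S a-two b-two d-two = cycle u∈S (a-two ∷ b-two ∷ []) d-two
        (λ { (here u≡a) → adj-irrefl (adj₁ a-two) (sym u≡a) ; (there (here u≡b)) → distinct a-two u≡b })
        (distinct b-two) (adj-sym (adj₁ a-two)) close₃

      pendant : ∀ {u w} → u ∈ S → (∀ {x} → x ∈ S → Adj u x → x ≡ w) → Colourable S
      pendant {u} {w} u∈S only
        with i , sole ← entrance u w
        with j , _ , i≢j , _ ← other-two i
        with c , valid ← erase {R = u ∷ []} u∈S (here refl) smaller
        with s , normal , look ← glance valid u i
        -- `close₂` serves as a source of distinct colours e, f, g such that e fits the state s at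
        -- the only possible neighbour.
        with e , f , g , (f≢g , f≢e , g≢e) , s⋈ , _ ← close₂ s normal
        with c₁ , valid₁ , _ ← join {e = e} {f} {g} valid i≢j (f≢e ∘ sym , g≢e ∘ sym , f≢g)
               (λ _ link → s , look link , s⋈)
               (λ (x∈S , _) link → ⊥-elim (i≢j (sym (sole (only x∈S (port-adj (proj₁ link))) (proj₁ link)))))
               (λ k≢i _ (x∈S , _) link → ⊥-elim (k≢i (sole (only x∈S (port-adj (proj₁ link))) (proj₁ link))))
        = restored valid₁

      -- The two sides meet at b: its palette is chosen first so that both can reach it, then a is
      -- coloured from e, next d and c from f, and b last.
      chain : ∀ {e a b c d f} → Two a e b → Two b a c → Two c b d → Two d c f → a ≢ d → a ≢ f → Colourable S
      chain {e} {a} {b} {c} {d} {f} a-two b-two c-two d-two a≢d a≢f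
        with κ , valid ← erase {R = a ∷ d ∷ c ∷ b ∷ []} (member a-two) (here refl) smaller
        with s , s-normal , s-sees ← sight valid a e
        with t , t-normal , t-sees ← sight valid d f
        with _ , _ , _ , _ , apart , ext₁ , ext₂ ← extends-one-two s s-normal t t-normal
        with κ₁ , valid₁ , frame₁ , _ , sees₁ , meets ⋈₁ ←
               leg 0 (a-two ∷ []) (there (there (here refl))) valid s-sees ext₁
        with κ₂ , valid₂ , frame₂ , _ , sees₂ , meets ⋈₂ ←
               leg 0 (flip d-two ∷ flip c-two ∷ []) (here refl) valid₁
               (sees-frame {c = κ} {κ₁} (frame₁ λ { (here f≡a) → a≢f (sym f≡a) }) t-sees) ext₂
        with κ₃ , valid₃ , _ ← join₂ b-two valid₂ apart
               (λ toA → fits-sees {c = κ₂} toA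
                 (sees-frame {c = κ₁} {κ₂}
                   (frame₂ λ { (here a≡d) → a≢d a≡d ; (there (here a≡c)) → distinct b-two a≡c }) sees₁) ⋈₁)
               (λ toC → fits-sees {c = κ₂} toC sees₂ ⋈₂)
        = restored valid₃

      module _ {u a₁ a₂ a₃ a₄ b₁ b₂ b₃ c₁ c₂}
        (u-three : Three u c₁ b₁ a₁)
        (A₁ : Two a₁ u a₂) (A₂ : Two a₂ a₁ a₃) (A₃ : Two a₃ a₂ a₄)
        (B₁ : Two b₁ u b₂) (B₂ : Two b₂ b₁ b₃) (C₁ : Two c₁ u c₂)
        (a₄-not-two : ∀ {x y} → ¬ Two a₄ x y) (a₄≢u : a₄ ≢ u) (b₃≢u : b₃ ≢ u) (c₁≢b₃ : c₁ ≢ b₃)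
        where

        private
          not-two : ∀ {x y} → ¬ Two u x y
          not-two = three-not-two u-three

          module _ {x y} (X : Two x u y) where

            -- Here x is the first vertex of a leg at u and y the next. The legs cannot overlap:
            -- tracing neighbours from a common vertex gives u or a₄ degree 2, or leads to an
            -- excluded coincidence.
            x≢a₂ : x ≢ a₂
            x≢a₂ refl with cover A₂ (Three.member u-three) (adj₁ X)
            ... | inj₁ refl = adj-irrefl (adj₁ A₁) refl
            ... | inj₂ refl = not-two A₃

            x≢a₃ : x ≢ a₃
            x≢a₃ refl with cover A₃ (Three.member u-three) (adj₁ X)
            ... | inj₁ refl = not-two A₂
            ... | inj₂ u≡a₄ = a₄≢u (sym u≡a₄)

            module _ (x≢a₁ : x ≢ a₁) where

              y≢a₁ : y ≢ a₁
              y≢a₁ refl with cover A₁ (member X) (adj-sym (adj₂ X))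
              ... | inj₁ refl = not-two X
              ... | inj₂ x≡a₂ = x≢a₂ x≡a₂

              y≢a₂ : y ≢ a₂
              y≢a₂ refl with cover A₂ (member X) (adj-sym (adj₂ X))
              ... | inj₁ x≡a₁ = x≢a₁ x≡a₁
              ... | inj₂ x≡a₃ = x≢a₃ x≡a₃

              y≢a₃ : y ≢ a₃
              y≢a₃ refl with cover A₃ (member X) (adj-sym (adj₂ X))
              ... | inj₁ x≡a₂ = x≢a₂ x≡a₂
              ... | inj₂ refl = a₄-not-two X

              y∉a : y ∉ₗ a₃ ∷ a₂ ∷ a₁ ∷ []
              y∉a (here y≡a₃)                 = y≢a₃ y≡a₃
              y∉a (there (here y≡a₂))         = y≢a₂ y≡a₂
              y∉a (there (there (here y≡a₁))) = y≢a₁ y≡a₁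

          c₁≢b₁ : c₁ ≢ b₁
          c₁≢b₁ = proj₁ (Three.distinct u-three)

          c₁≢a₁ : c₁ ≢ a₁
          c₁≢a₁ = proj₁ (proj₂ (Three.distinct u-three))

          b₁≢a₁ : b₁ ≢ a₁
          b₁≢a₁ = proj₂ (proj₂ (Three.distinct u-three))

          -- The legs are coloured in the order a, b, c. The outer vertices b₃ and c₂ must avoid the
          -- legs coloured before their own, or the states seen there would be outdated.
          b₃∉a : b₃ ∉ₗ a₃ ∷ a₂ ∷ a₁ ∷ []
          b₃∉a (here refl) with cover A₃ (member B₂) (adj-sym (adj₂ B₂))
          ... | inj₁ b₂≡a₂ = y≢a₂ B₁ b₁≢a₁ b₂≡a₂
          ... | inj₂ refl  = a₄-not-two B₂
          b₃∉a (there (here refl)) with cover A₂ (member B₂) (adj-sym (adj₂ B₂))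
          ... | inj₁ b₂≡a₁ = y≢a₁ B₁ b₁≢a₁ b₂≡a₁
          ... | inj₂ b₂≡a₃ = y≢a₃ B₁ b₁≢a₁ b₂≡a₃
          b₃∉a (there (there (here refl))) with cover A₁ (member B₂) (adj-sym (adj₂ B₂))
          ... | inj₁ refl  = not-two B₂
          ... | inj₂ b₂≡a₂ = y≢a₂ B₁ b₁≢a₁ b₂≡a₂

          c₂∉b : c₂ ∉ₗ b₂ ∷ b₁ ∷ []
          c₂∉b (here refl) with cover B₂ (member C₁) (adj-sym (adj₂ C₁))
          ... | inj₁ c₁≡b₁ = c₁≢b₁ c₁≡b₁
          ... | inj₂ c₁≡b₃ = c₁≢b₃ c₁≡b₃
          c₂∉b (there (here refl)) with cover B₁ (member C₁) (adj-sym (adj₂ C₁))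
          ... | inj₁ refl = not-two C₁
          ... | inj₂ refl with cover B₂ (Three.member u-three) (adj₁ C₁)
          ...   | inj₁ refl = not-two B₁
          ...   | inj₂ u≡b₃ = b₃≢u (sym u≡b₃)

          a₁∉b : a₁ ∉ₗ b₂ ∷ b₁ ∷ []
          a₁∉b (here a₁≡b₂)         = y≢a₁ B₁ b₁≢a₁ (sym a₁≡b₂)
          a₁∉b (there (here a₁≡b₁)) = b₁≢a₁ (sym a₁≡b₁)

          three-leg : ∀ {s e f g} → Normal s → e ≡ 0c ⊎ f ≡ 0c → Apart ⟨ e ∣ f , g ⟩ → Extends 3 s ⟨ g ∣ e , f ⟩
          three-leg normal (inj₁ refl) (e≢f , e≢g , f≢g) =
            proj₁ (extends-three _ normal _ _ (e≢g ∘ sym , f≢g ∘ sym , e≢f))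
          three-leg normal (inj₂ refl) (e≢f , e≢g , f≢g) =
            proj₂ (extends-three _ normal _ _ (f≢g ∘ sym , e≢g ∘ sym , e≢f ∘ sym))

          Toward : (V → Palette) → V → State → Set
          Toward κ x t = ∃ λ s → Sees κ u x s × s ⋈ t

          toward-frame : ∀ {κ κ′ x t} → κ′ x ≡ κ x → Toward κ x t → Toward κ′ x t
          toward-frame {κ} {κ′} eq (s , sees , s⋈t) = s , sees-frame {c = κ} {κ′} eq sees , s⋈t

          -- With u still absent, the legs are coloured from their outer ends inwards, each towards
          -- its prescribed side of the palette of u.
          legs : ∀ {κ r s t e f g} → Valid (Without S (a₃ ∷ a₂ ∷ a₁ ∷ b₂ ∷ b₁ ∷ c₁ ∷ u ∷ [])) κ →
            Sees κ a₃ a₄ r → Sees κ b₂ b₃ s → Sees κ c₁ c₂ t →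
            Extends 3 r ⟨ g ∣ e , f ⟩ → Extends 2 s ⟨ f ∣ e , g ⟩ → Extends 1 t ⟨ e ∣ f , g ⟩ →
            ∃ λ κ′ → Valid (Without S (u ∷ [])) κ′ ×
              Toward κ′ c₁ ⟨ e ∣ f , g ⟩ × Toward κ′ b₁ ⟨ f ∣ e , g ⟩ × Toward κ′ a₁ ⟨ g ∣ e , f ⟩
          legs {κ} valid r-sees s-sees t-sees ext₃ ext₂ ext₁
            with κ₁ , valid₁ , frame₁ , _ , a-sees , meets a⋈ ←
              leg 0 (flip A₃ ∷ flip A₂ ∷ flip A₁ ∷ []) (there (there (there (here refl)))) valid r-sees ext₃
            with κ₂ , valid₂ , frame₂ , _ , b-sees , meets b⋈ ←
              leg 0 (flip B₂ ∷ flip B₁ ∷ []) (there (here refl)) valid₁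
                (sees-frame {c = κ} {κ₁} (frame₁ b₃∉a) s-sees) ext₂
            with κ₃ , valid₃ , frame₃ , _ , c-sees , meets c⋈ ←
              leg 0 (flip C₁ ∷ []) (here refl) valid₂
                (sees-frame {c = κ} {κ₂} (trans (frame₂ c₂∉b) (frame₁ (y∉a C₁ c₁≢a₁))) t-sees) ext₁
            = κ₃ , valid₃ , (_ , c-sees , c⋈) ,
              toward-frame {κ₂} {κ₃} (frame₃ λ { (here b₁≡c₁) → c₁≢b₁ (sym b₁≡c₁) }) (_ , b-sees , b⋈) ,
              toward-frame {κ₁} {κ₃} (trans (frame₃ λ { (here a₁≡c₁) → c₁≢a₁ (sym a₁≡c₁) }) (frame₂ a₁∉b))
                (_ , a-sees , a⋈)

          centre : ∀ {κ e f g} → Valid (Without S (u ∷ [])) κ → Apart ⟨ e ∣ f , g ⟩ →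
            Toward κ c₁ ⟨ e ∣ f , g ⟩ → Toward κ b₁ ⟨ f ∣ e , g ⟩ → Toward κ a₁ ⟨ g ∣ e , f ⟩ → Colourable S
          centre {κ} valid apart (_ , c-sees , c⋈) (_ , b-sees , b⋈) (_ , a-sees , a⋈)
            with uc , ub , ua ← Three.adjacent u-three
            with i , toC ← port-to uc
            with j , toB ← port-to ub
            with _ , valid′ , _ ← join valid (ports-differ c₁≢b₁ toC toB) apart
                   (fits-sees {c = κ} toC c-sees c⋈)
                   (fits-sees {c = κ} toB b-sees b⋈)
                   (λ k≢i k≢j (x∈S , _) link → case Three.cover u-three x∈S (port-adj (proj₁ link)) of λ
                     { (inj₁ refl)        → ⊥-elim (k≢i (port-inj (proj₁ link) toC))
                     ; (inj₂ (inj₁ refl)) → ⊥-elim (k≢j (port-inj (proj₁ link) toB))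
                     ; (inj₂ (inj₂ refl)) → _ , a-sees link , a⋈ })
            = restored valid′

        spider : Colourable S
        spider
          with κ , valid ← erase {R = a₃ ∷ a₂ ∷ a₁ ∷ b₂ ∷ b₁ ∷ c₁ ∷ u ∷ []} (member A₃) (here refl) smaller
          with r , r-normal , r-sees ← sight valid a₃ a₄
          with s , s-normal , s-sees ← sight valid b₂ b₃
          with t , t-normal , t-sees ← sight valid c₁ c₂
          -- The palette of u is fixed before any leg is coloured: e towards c₁, f towards b₁, g
          -- towards a₁. A 0 at e or f is what the leg of three vertices needs.
          with e , f , g , zero? , apart , ext₁ , ext₂ ← extends-one-two t t-normal s s-normal
          with κ′ , valid′ , c-toward , b-toward , a-toward ←
            legs valid r-sees s-sees t-sees (three-leg r-normal zero? apart) ext₂ ext₁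
          = centre valid′ apart c-toward b-toward a-toward

-- Sums over the vertices

sum-mono : ∀ {n} {f g : Fin n → ℕ} → (∀ i → f i ≤ g i) → sum f ≤ sum g
sum-mono {zero}  f≤g = z≤n
sum-mono {suc n} f≤g = ℕ.+-mono-≤ (f≤g zero) (sum-mono (f≤g ∘ suc))

point : ∀ {n} → Fin n → ℕ → Fin n → ℕ
point x c w = if does (w Fin.≟ x) then c else 0

sum-point : ∀ {n} (x : Fin n) c → sum (point x c) ≡ c
sum-point {suc n} zero c = trans (cong₂ _+_ refl (sum-replicate-zero n)) (ℕ.+-identityʳ c)
sum-point (suc x) c = sum-point x c

module _ {n} {f : Fin n → ℕ} where

  private
    points₂ : ∀ x y → sum (λ w → point x (f x) w + point y (f y) w) ≡ f x + f y
    points₂ x y = trans (∑-distrib-+ (point x (f x)) (point y (f y))) (cong₂ _+_ (sum-point x _) (sum-point y _))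

    points₃ : ∀ x y z → sum (λ w → point x (f x) w + (point y (f y) w + point z (f z) w)) ≡ f x + (f y + f z)
    points₃ x y z = trans (∑-distrib-+ (point x (f x)) _) (cong₂ _+_ (sum-point x _) (points₂ y z))

  sum-≥₂ : ∀ {x y} → x ≢ y → f x + f y ≤ sum f
  sum-≥₂ {x} {y} x≢y = subst (_≤ sum f) (points₂ x y) (sum-mono below)
    where
    below : ∀ w → point x (f x) w + point y (f y) w ≤ f w
    below w with w Fin.≟ x | w Fin.≟ y
    ... | yes refl | yes refl = ⊥-elim (x≢y refl)
    ... | yes refl | no _     = ℕ.≤-reflexive (ℕ.+-identityʳ _)
    ... | no _     | yes refl = ℕ.≤-refl
    ... | no _     | no _     = z≤n

  sum-≥₃ : ∀ {x y z} → x ≢ y → x ≢ z → y ≢ z → f x + (f y + f z) ≤ sum f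
  sum-≥₃ {x} {y} {z} x≢y x≢z y≢z = subst (_≤ sum f) (points₃ x y z) (sum-mono below)
    where
    below : ∀ w → point x (f x) w + (point y (f y) w + point z (f z) w) ≤ f w
    below w with w Fin.≟ x | w Fin.≟ y | w Fin.≟ z
    ... | yes refl | yes refl | _        = ⊥-elim (x≢y refl)
    ... | yes refl | no _     | yes refl = ⊥-elim (x≢z refl)
    ... | yes refl | no _     | no _     = ℕ.≤-reflexive (ℕ.+-identityʳ _)
    ... | no _     | yes refl | yes refl = ⊥-elim (y≢z refl)
    ... | no _     | yes refl | no _     = ℕ.≤-reflexive (ℕ.+-identityʳ _)
    ... | no _     | no _     | yes refl = ℕ.≤-refl
    ... | no _     | no _     | no _     = z≤n

  sum-≤₂ : ∀ {x y} → (∀ {w} → w ≢ x → w ≢ y → f w ≡ 0) → sum f ≤ f x + f y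
  sum-≤₂ {x} {y} support = subst (sum f ≤_) (points₂ x y) (sum-mono above)
    where
    above : ∀ w → f w ≤ point x (f x) w + point y (f y) w
    above w with w Fin.≟ x | w Fin.≟ y
    ... | yes refl | _        = ℕ.m≤m+n _ _
    ... | no _     | yes refl = ℕ.≤-refl
    ... | no w≢x   | no w≢y   = ℕ.≤-reflexive (support w≢x w≢y)

  sum-≤₃ : ∀ {x y z} → (∀ {w} → w ≢ x → w ≢ y → w ≢ z → f w ≡ 0) → sum f ≤ f x + (f y + f z)
  sum-≤₃ {x} {y} {z} support = subst (sum f ≤_) (points₃ x y z) (sum-mono above)
    where
    above : ∀ w → f w ≤ point x (f x) w + (point y (f y) w + point z (f z) w)
    above w with w Fin.≟ x | w Fin.≟ y | w Fin.≟ z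
    ... | yes refl | _        | _        = ℕ.m≤m+n _ _
    ... | no _     | yes refl | _        = ℕ.m≤m+n _ _
    ... | no _     | no _     | yes refl = ℕ.≤-refl
    ... | no w≢x   | no w≢y   | no w≢z   = ℕ.≤-reflexive (support w≢x w≢y w≢z)

-- C will be `Colourable S`: a reduction found at one vertex ends the argument, and otherwise P
-- holds throughout.
either-all : ∀ {n} {C : Set} {P : Fin n → Set} → (∀ i → C ⊎ P i) → C ⊎ (∀ i → P i)
either-all {zero}  f = inj₂ λ ()
either-all {suc n} f with f zero | either-all (f ∘ suc)
... | inj₁ c | _      = inj₁ c
... | inj₂ _ | inj₁ c = inj₁ c
... | inj₂ p | inj₂ q = inj₂ λ { zero → p ; (suc i) → q i }

-- Discharging

opaque
  -- Three numbers at most 3 with sum above 6 include a 3. The other two then sum to at least 4, so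
  -- both are positive and one is at least 2, as `long-legs` requires.
  excess : ∀ (i j k : Fin 4) → (toℕ i + (toℕ j + toℕ k) ≤ 6) ⊎
    (i ≡ 3F × 2 ≤ toℕ j × 1 ≤ toℕ k) ⊎ (i ≡ 3F × 1 ≤ toℕ j × 2 ≤ toℕ k) ⊎
    (j ≡ 3F × 2 ≤ toℕ k × 1 ≤ toℕ i) ⊎ (j ≡ 3F × 1 ≤ toℕ k × 2 ≤ toℕ i) ⊎
    (k ≡ 3F × 2 ≤ toℕ i × 1 ≤ toℕ j) ⊎ (k ≡ 3F × 1 ≤ toℕ i × 2 ≤ toℕ j)
  excess = from-yes (Fin.all? {n = 4} λ i → Fin.all? {n = 4} λ j → Fin.all? {n = 4} λ k →
    (toℕ i + (toℕ j + toℕ k) ℕ.≤? 6) ⊎-dec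
    (i Fin.≟ 3F ×-dec 2 ℕ.≤? toℕ j ×-dec 1 ℕ.≤? toℕ k) ⊎-dec (i Fin.≟ 3F ×-dec 1 ℕ.≤? toℕ j ×-dec 2 ℕ.≤? toℕ k) ⊎-dec
    (j Fin.≟ 3F ×-dec 2 ℕ.≤? toℕ k ×-dec 1 ℕ.≤? toℕ i) ⊎-dec (j Fin.≟ 3F ×-dec 1 ℕ.≤? toℕ k ×-dec 2 ℕ.≤? toℕ i) ⊎-dec
    (k Fin.≟ 3F ×-dec 2 ℕ.≤? toℕ i ×-dec 1 ℕ.≤? toℕ j) ⊎-dec (k Fin.≟ 3F ×-dec 1 ℕ.≤? toℕ i ×-dec 2 ℕ.≤? toℕ j))

module Discharging {n} (G : Graph n) (ports : Ports G) (S : Subset n) where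
  open Ports ports
  open Extension G ports

  private
    V = Fin n

  Within : V → V → Set
  Within v w = v ∈ S × w ∈ S × Adj v w

  within? : ∀ v w → Dec (Within v w)
  within? v w = v ∈? S ×-dec w ∈? S ×-dec adj G v w Bool.≟ true

  within-sym : ∀ {v w} → Within v w → Within w v
  within-sym (v∈S , w∈S , vw) = w∈S , v∈S , adj-sym vw

  weigh : V → V → ℕ → ℕ
  weigh v w x = if does (within? v w) then x else 0

  weigh-in : ∀ {v w x} → Within v w → weigh v w x ≡ x
  weigh-in {v} {w} vw rewrite dec-true (within? v w) vw = refl

  weigh-out : ∀ {v w x} → ¬ Within v w → weigh v w x ≡ 0
  weigh-out {v} {w} ¬vw rewrite dec-false (within? v w) ¬vw = refl

  indicator : V → ℕ
  indicator v = if does (v ∈? S) then 1 else 0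

  indicator-in : ∀ {v} → v ∈ S → indicator v ≡ 1
  indicator-in {v} v∈S rewrite dec-true (v ∈? S) v∈S = refl

  indicator-out : ∀ {v} → v ∉ S → indicator v ≡ 0
  indicator-out {v} v∉S rewrite dec-false (v ∈? S) v∉S = refl

  -- The double sum is twice the number of edges inside S, so this bounds the average degree by 18/8
  -- = 9/4.
  Sparse : Set
  Sparse = 8 * sum (λ v → sum (λ w → weigh v w 1)) ℕ.< 18 * sum indicator

  Kind : V → Set
  Kind v = (∃₂ λ x y → Two {S} v x y) ⊎ (∃ λ x → ∃₂ λ y z → Three {S} v x y z)

  module _ (smaller : ∀ T → T ⊂ S → Colourable T) where
    open Reductions {S} smaller

    exit : ∀ v i → (∃ λ x → port v i ≡ just x × x ∈ S) ⊎ (∀ {x} → port v i ≡ just x → x ∉ S)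
    exit v i with port v i
    ... | nothing = inj₂ λ ()
    ... | just x with x ∈? S
    ...   | yes x∈S = inj₁ (x , refl , x∈S)
    ...   | no x∉S  = inj₂ λ { refl → x∉S }

    kind : ∀ {v} → v ∈ S → Colourable S ⊎ Kind v
    kind {v} v∈S = classify (exit v 0F) (exit v 1F) (exit v 2F)
      where
      Port : Fin 3 → Set
      Port i = (∃ λ x → port v i ≡ just x × x ∈ S) ⊎ (∀ {x} → port v i ≡ just x → x ∉ S)

      covers : ∀ {P : V → Set} →
        (∀ {w} → w ∈ S → port v 0F ≡ just w → P w) → (∀ {w} → w ∈ S → port v 1F ≡ just w → P w) →
        (∀ {w} → w ∈ S → port v 2F ≡ just w → P w) → ∀ {w} → w ∈ S → Adj v w → P w
      covers f g h w∈S vw with port-to vw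
      ... | 0F , to = f w∈S to
      ... | 1F , to = g w∈S to
      ... | 2F , to = h w∈S to

      same : ∀ {i x w} → port v i ≡ just x → port v i ≡ just w → w ≡ x
      same toX toW = Maybe.just-injective (trans (sym toW) toX)

      no-exit : ∀ {P : Set} {i w} → (∀ {x} → port v i ≡ just x → x ∉ S) → w ∈ S → port v i ≡ just w → P
      no-exit none w∈S to = ⊥-elim (none to w∈S)

      differ : ∀ {i j x y} → i ≢ j → port v i ≡ just x → port v j ≡ just y → x ≢ y
      differ i≢j toX toY refl = i≢j (port-inj toX toY)

      both : ∀ {i j x y} → i ≢ j → port v i ≡ just x → x ∈ S → port v j ≡ just y → y ∈ S →
        (∀ {w} → w ∈ S → Adj v w → w ≡ x ⊎ w ≡ y) → Kind v
      both i≢j toX x∈S toY y∈S cov =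
        inj₁ (_ , _ , two v∈S (x∈S , y∈S) (differ i≢j toX toY) (port-adj toX) (port-adj toY) cov)

      classify : Port 0F → Port 1F → Port 2F → Colourable S ⊎ Kind v
      classify (inj₁ (x , toX , x∈S)) (inj₁ (y , toY , y∈S)) (inj₁ (z , toZ , z∈S)) =
        inj₂ (inj₂ (x , y , z , three v∈S (x∈S , y∈S , z∈S)
          (differ (λ ()) toX toY , differ (λ ()) toX toZ , differ (λ ()) toY toZ)
          (port-adj toX , port-adj toY , port-adj toZ)
          (covers (λ _ → inj₁ ∘ same toX) (λ _ → inj₂ ∘ inj₁ ∘ same toY) (λ _ → inj₂ ∘ inj₂ ∘ same toZ))))
      classify (inj₁ (x , toX , x∈S)) (inj₁ (y , toY , y∈S)) (inj₂ none) =
        inj₂ (both (λ ()) toX x∈S toY y∈S (covers (λ _ → inj₁ ∘ same toX) (λ _ → inj₂ ∘ same toY) (no-exit none)))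
      classify (inj₁ (x , toX , x∈S)) (inj₂ none) (inj₁ (z , toZ , z∈S)) =
        inj₂ (both (λ ()) toX x∈S toZ z∈S (covers (λ _ → inj₁ ∘ same toX) (no-exit none) (λ _ → inj₂ ∘ same toZ)))
      classify (inj₂ none) (inj₁ (y , toY , y∈S)) (inj₁ (z , toZ , z∈S)) =
        inj₂ (both (λ ()) toY y∈S toZ z∈S (covers (no-exit none) (λ _ → inj₁ ∘ same toY) (λ _ → inj₂ ∘ same toZ)))
      classify (inj₁ (x , toX , _)) (inj₂ none) (inj₂ none′) =
        inj₁ (pendant v∈S (covers {λ x → x ≡ _} (λ _ → same toX) (no-exit none) (no-exit none′)))
      classify (inj₂ none) (inj₁ (y , toY , _)) (inj₂ none′) =
        inj₁ (pendant v∈S (covers {λ x → x ≡ _} (no-exit none) (λ _ → same toY) (no-exit none′)))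
      classify (inj₂ none) (inj₂ none′) (inj₁ (z , toZ , _)) =
        inj₁ (pendant v∈S (covers {λ x → x ≡ _} (no-exit none) (no-exit none′) (λ _ → same toZ)))
      classify (inj₂ none) (inj₂ none′) (inj₂ none″) =
        -- No port leads into S, so the condition on w is vacuous and v can stand in for it.
        inj₁ (pendant {w = v} v∈S (covers {λ x → x ≡ v} (no-exit none) (no-exit none′) (no-exit none″)))

    module _ (kinds : ∀ {v} → v ∈ S → Kind v) where

      onward : V → V → Maybe V
      onward v w with w ∈? S
      ... | no _ = nothing
      ... | yes w∈S with kinds w∈S
      ...   | inj₂ _             = nothing
      ...   | inj₁ (x , y , _) = if does (x Fin.≟ v) then just y else just x

      data Onward (v w : V) : Maybe V → Set where
        stop : ∀ {x y z} → Three {S} w x y z → Onward v w nothing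
        go   : ∀ {x} → Two {S} w v x → Onward v w (just x)

      look-onward : ∀ {v w} → Within v w → Onward v w (onward v w)
      look-onward {v} {w} (v∈S , w∈S , vw) with w ∈? S
      ... | no w∉S = ⊥-elim (w∉S w∈S)
      ... | yes w∈S with kinds w∈S
      ...   | inj₂ (_ , _ , _ , w-three) = stop w-three
      ...   | inj₁ (x , y , w-two) with x Fin.≟ v | Two.cover w-two v∈S (adj-sym vw)
      ...     | yes refl | _         = go w-two
      ...     | no x≢v   | inj₁ v≡x  = ⊥-elim (x≢v (sym v≡x))
      ...     | no _     | inj₂ refl = go (flip w-two)

      -- Coming from v, the number of vertices of degree 2 from w onwards, counted up to k.
      run : ℕ → V → V → ℕ
      run zero    v w = 0
      run (suc k) v w = maybe (λ x → suc (run k w x)) 0 (onward v w)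

      onward-two : ∀ {v w x} → Two {S} w v x → onward v w ≡ just x
      onward-two {v} {w} {x} w-two
        with onward v w | look-onward {v} {w}
               (proj₁ (Two.members w-two) , Two.member w-two , adj-sym (Two.adj₁ w-two))
      ... | _ | stop w-three = ⊥-elim (three-not-two w-three w-two)
      ... | _ | go {y} w-two′ with Two.cover w-two (proj₂ (Two.members w-two′)) (Two.adj₂ w-two′)
      ...   | inj₁ refl = ⊥-elim (Two.distinct w-two′ refl)
      ...   | inj₂ refl = refl

      data Leg (v w : V) : Fin 4 → Set where
        leg₀ : ∀ {x y z} → Three {S} w x y z → Leg v w 0F
        leg₁ : ∀ {a x y z} → Two {S} w v a → Three {S} a x y z → Leg v w 1F
        leg₂ : ∀ {a b x y z} → Two {S} w v a → Two {S} a w b → Three {S} b x y z → Leg v w 2F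
        leg₃ : ∀ {a b c x y z} → Two {S} w v a → Two {S} a w b → Two {S} b a c → Three {S} c x y z → Leg v w 3F

      next-within : ∀ {v w x} → Two {S} w v x → Within w x
      next-within w-two = Two.member w-two , proj₂ (Two.members w-two) , Two.adj₂ w-two

      -- A fourth vertex of degree 2 in a row always gives a reduction. Both cutoffs are recorded
      -- because `run 4`, taken one step further back, is one more than `run 3` from here.
      measure : ∀ {v w} → Within v w →
        Colourable S ⊎ (∃ λ k → Leg v w k × run 3 v w ≡ toℕ k × run 4 v w ≡ toℕ k)
      measure {v} {w} vw with onward v w | look-onward vw
      ... | _ | stop w-three = inj₂ (0F , leg₀ w-three , refl , refl)
      ... | _ | go {a} W with onward w a | look-onward (next-within W)
      ...   | _ | stop a-three = inj₂ (1F , leg₁ W a-three , refl , refl)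
      ...   | _ | go {b} A with onward a b | look-onward (next-within A)
      ...     | _ | stop b-three = inj₂ (2F , leg₂ W A b-three , refl , refl)
      ...     | _ | go {c} B with onward b c | look-onward (next-within B)
      ...       | _ | stop c-three = inj₂ (3F , leg₃ W A B c-three , refl , refl)
      -- Now w, a, b, c all have degree 2: c = w is a triangle, d = w a 4-cycle, and otherwise
      -- `chain` applies.
      ...       | _ | go {d} C with w Fin.≟ c | w Fin.≟ d
      ...         | yes refl | _        = inj₁ (triangle (Two.member W) A B)
      ...         | no _     | yes refl = inj₁ (square (Two.member W) A B C)
      ...         | no w≢c   | no w≢d   = inj₁ (chain W A B C w≢c w≢d)

      LegAtLeast₁ : V → V → Set
      LegAtLeast₁ u c = ∃ λ c₂ → Two {S} c u c₂

      LegAtLeast₂ : V → V → Set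
      LegAtLeast₂ u b = ∃ λ b₂ → Two {S} b u b₂ × ∃ λ b₃ → Two {S} b₂ b b₃

      at-least₁ : ∀ {u c k} → Leg u c k → 1 ≤ toℕ k → LegAtLeast₁ u c
      at-least₁ (leg₁ C _)     _ = _ , C
      at-least₁ (leg₂ C _ _)   _ = _ , C
      at-least₁ (leg₃ C _ _ _) _ = _ , C

      at-least₂ : ∀ {u b k} → Leg u b k → 2 ≤ toℕ k → LegAtLeast₂ u b
      at-least₂ (leg₁ _ _)     (s≤s ())
      at-least₂ (leg₂ B C _)   _ = _ , B , _ , C
      at-least₂ (leg₃ B C _ _) _ = _ , B , _ , C

      -- Each coincidence forbidden by `spider` closes a triangle or 4-cycle through u whose other
      -- vertices have degree 2, or would give u degree 2.
      long-legs : ∀ {u a b c} → Three {S} u c b a → Leg u a 3F → LegAtLeast₂ u b → LegAtLeast₁ u c → Colourable S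
      long-legs {u} {c = c} U (leg₃ {c = a₄} A₁ A₂ A₃ a₄-three) (b₂ , B₁ , b₃ , B₂) (c₂ , C)
        with a₄ Fin.≟ u | b₃ Fin.≟ u | c Fin.≟ b₃
      ... | yes refl | _        | _        = square (Three.member U) A₁ A₂ A₃
      ... | no _     | yes refl | _        = triangle (Three.member U) B₁ B₂
      ... | no _     | no _     | yes refl with Two.cover C (Two.member B₂) (adj-sym (Two.adj₂ B₂))
      ...   | inj₁ refl = ⊥-elim (three-not-two U B₂)
      ...   | inj₂ refl = square (Three.member U) B₁ B₂ (flip C)
      long-legs U (leg₃ A₁ A₂ A₃ a₄-three) (b₂ , B₁ , b₃ , B₂) (c₂ , C) | no a₄≢u | no b₃≢u | no c≢b₃ =
        spider U A₁ A₂ A₃ B₁ B₂ C (three-not-two a₄-three) a₄≢u b₃≢u c≢b₃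

      -- The charge passing from v to w: one unit for each vertex of degree 2 ahead on the thread.
      -- Routing payments edge by edge lets the balance be checked at each vertex alone.
      flow : V → V → ℕ
      flow v w = weigh v w (run 4 v w)

      income : V → V → ℕ
      income v w = 8 * weigh v w 1 + flow w v

      -- Charges are scaled so that a vertex of degree d starts with 8 d − 18.
      Balanced : V → Set
      Balanced v = 18 * indicator v + sum (flow v) ≤ sum (income v)

      rotate : ∀ {u x y z} → Three {S} u x y z → Three {S} u y z x
      rotate (three m (x∈ , y∈ , z∈) (x≢y , x≢z , y≢z) (ux , uy , uz) cov) =
        three m (y∈ , z∈ , x∈) (y≢z , x≢y ∘ sym , x≢z ∘ sym) (uy , uz , ux) λ w∈ uw →
          case cov w∈ uw of λ
            { (inj₁ p) → inj₂ (inj₂ p) ; (inj₂ (inj₁ p)) → inj₁ p ; (inj₂ (inj₂ p)) → inj₂ (inj₁ p) }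

      mirror : ∀ {u x y z} → Three {S} u x y z → Three {S} u z y x
      mirror (three m (x∈ , y∈ , z∈) (x≢y , x≢z , y≢z) (ux , uy , uz) cov) =
        three m (z∈ , y∈ , x∈) (y≢z ∘ sym , x≢z ∘ sym , x≢y ∘ sym) (uz , uy , ux) λ w∈ uw →
          case cov w∈ uw of λ
            { (inj₁ p) → inj₂ (inj₂ p) ; (inj₂ (inj₁ p)) → inj₂ (inj₁ p) ; (inj₂ (inj₂ p)) → inj₁ p }

      short-legs : ∀ {u x y z i j k} → Three {S} u x y z → Leg u x i → Leg u y j → Leg u z k →
        Colourable S ⊎ (toℕ i + (toℕ j + toℕ k) ≤ 6)
      short-legs {i = i} {j} {k} U X Y Z with excess i j k
      ... | inj₁ few = inj₂ few
      ... | inj₂ (inj₁ (refl , 2≤j , 1≤k)) =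
        inj₁ (long-legs (mirror U) X (at-least₂ Y 2≤j) (at-least₁ Z 1≤k))
      ... | inj₂ (inj₂ (inj₁ (refl , 1≤j , 2≤k))) =
        inj₁ (long-legs (rotate U) X (at-least₂ Z 2≤k) (at-least₁ Y 1≤j))
      ... | inj₂ (inj₂ (inj₂ (inj₁ (refl , 2≤k , 1≤i)))) =
        inj₁ (long-legs (mirror (rotate U)) Y (at-least₂ Z 2≤k) (at-least₁ X 1≤i))
      ... | inj₂ (inj₂ (inj₂ (inj₂ (inj₁ (refl , 1≤k , 2≤i))))) =
        inj₁ (long-legs (rotate (rotate U)) Y (at-least₂ X 2≤i) (at-least₁ Z 1≤k))
      ... | inj₂ (inj₂ (inj₂ (inj₂ (inj₂ (inj₁ (refl , 2≤i , 1≤j)))))) =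
        inj₁ (long-legs (mirror (rotate (rotate U))) Z (at-least₂ X 2≤i) (at-least₁ Y 1≤j))
      ... | inj₂ (inj₂ (inj₂ (inj₂ (inj₂ (inj₂ (refl , 1≤i , 2≤j)))))) =
        inj₁ (long-legs U Z (at-least₂ Y 2≤j) (at-least₁ X 1≤i))

      outside-balanced : ∀ {v} → v ∉ S → Balanced v
      outside-balanced {v} v∉S = begin
        18 * indicator v + sum (flow v)
          ≤⟨ ℕ.+-mono-≤ (ℕ.≤-reflexive (cong (18 *_) (indicator-out v∉S)))
                        (sum-mono λ w → ℕ.≤-reflexive (weigh-out {v} {w} (v∉S ∘ proj₁))) ⟩
        sum {n} (λ _ → 0)
          ≡⟨ sum-replicate-zero n ⟩
        0
          ≤⟨ z≤n ⟩
        sum (income v) ∎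
        where open ℕ.≤-Reasoning

      two-balanced : ∀ {v x y} → Two {S} v x y → Colourable S ⊎ Balanced v
      two-balanced {v} {x} {y} v-two@(two v∈S (x∈S , y∈S) x≢y ax ay cov)
        with measure (v∈S , x∈S , ax) | measure (v∈S , y∈S , ay)
      ... | inj₁ done | _         = inj₁ done
      ... | inj₂ _    | inj₁ done = inj₁ done
      ... | inj₂ (k , _ , x₃ , x₄) | inj₂ (l , _ , y₃ , y₄) = inj₂ (begin
        18 * indicator v + sum (flow v)
          ≤⟨ ℕ.+-mono-≤ (ℕ.≤-reflexive (cong (18 *_) (indicator-in v∈S))) (sum-≤₂ support) ⟩
        18 + (flow v x + flow v y)
          ≡⟨ cong (λ m → 18 + m) (cong₂ _+_ (trans (weigh-in vx) x₄) (trans (weigh-in vy) y₄)) ⟩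
        18 + (toℕ k + toℕ l)
          -- What comes in from x is what goes out to y plus one unit that v keeps, and likewise
          -- from y. With 8 for each incident edge, v gains exactly 18.
          ≡⟨ identity (toℕ k) (toℕ l) ⟩
        (8 + suc (toℕ l)) + (8 + suc (toℕ k))
          ≡⟨ cong₂ _+_ (received vx (back v-two y₃)) (received vy (back (flip v-two) x₃)) ⟨
        income v x + income v y
          ≤⟨ sum-≥₂ x≢y ⟩
        sum (income v) ∎)
        where
        open ℕ.≤-Reasoning
        vx : Within v x
        vx = v∈S , x∈S , ax
        vy : Within v y
        vy = v∈S , y∈S , ay
        support : ∀ {w} → w ≢ x → w ≢ y → flow v w ≡ 0
        support w≢x w≢y = weigh-out λ (_ , w∈S , vw) → Sum.[ w≢x , w≢y ] (cov w∈S vw)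
        back : ∀ {a b m} → Two {S} v a b → run 3 v b ≡ m → run 4 a v ≡ suc m
        back {a} {b} v-two′ eq = trans (cong (maybe (λ x → suc (run 3 v x)) 0) (onward-two v-two′)) (cong suc eq)
        received : ∀ {w m} → Within v w → run 4 w v ≡ m → income v w ≡ 8 + m
        received vw eq = cong₂ (λ a b → 8 * a + b) (weigh-in vw) (trans (weigh-in (within-sym vw)) eq)
        identity : ∀ k l → 18 + (k + l) ≡ (8 + suc l) + (8 + suc k)
        identity = solve-∀

      three-balanced : ∀ {v x y z} → Three {S} v x y z → Colourable S ⊎ Balanced v
      three-balanced {v} {x} {y} {z} v-three@(three v∈S (x∈S , y∈S , z∈S) (x≢y , x≢z , y≢z) (ax , ay , az) cov)
        with measure (v∈S , x∈S , ax) | measure (v∈S , y∈S , ay) | measure (v∈S , z∈S , az)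
      ... | inj₁ done | _         | _         = inj₁ done
      ... | inj₂ _    | inj₁ done | _         = inj₁ done
      ... | inj₂ _    | inj₂ _    | inj₁ done = inj₁ done
      ... | inj₂ (i , X , _ , x₄) | inj₂ (j , Y , _ , y₄) | inj₂ (k , Z , _ , z₄) with short-legs v-three X Y Z
      ...   | inj₁ done = inj₁ done
      ...   | inj₂ few = inj₂ (begin
        18 * indicator v + sum (flow v)
          ≤⟨ ℕ.+-mono-≤ (ℕ.≤-reflexive (cong (18 *_) (indicator-in v∈S))) (sum-≤₃ support) ⟩
        18 + (flow v x + (flow v y + flow v z))
          ≡⟨ cong (λ m → 18 + m) (cong₂ _+_ (trans (weigh-in vx) x₄)
               (cong₂ _+_ (trans (weigh-in vy) y₄) (trans (weigh-in vz) z₄))) ⟩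
        18 + (toℕ i + (toℕ j + toℕ k))
          -- Three edges bring 24, which covers 18 and the at most 6 units sent out.
          ≤⟨ ℕ.+-monoʳ-≤ 18 few ⟩
        8 + (8 + 8)
          ≤⟨ ℕ.+-mono-≤ (enough vx) (ℕ.+-mono-≤ (enough vy) (enough vz)) ⟩
        income v x + (income v y + income v z)
          ≤⟨ sum-≥₃ x≢y x≢z y≢z ⟩
        sum (income v) ∎)
        where
        open ℕ.≤-Reasoning
        vx : Within v x
        vx = v∈S , x∈S , ax
        vy : Within v y
        vy = v∈S , y∈S , ay
        vz : Within v z
        vz = v∈S , z∈S , az
        support : ∀ {w} → w ≢ x → w ≢ y → w ≢ z → flow v w ≡ 0
        support w≢x w≢y w≢z = weigh-out λ (_ , w∈S , vw) → Sum.[ w≢x , Sum.[ w≢y , w≢z ] ] (cov w∈S vw)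
        enough : ∀ {w} → Within v w → 8 ≤ income v w
        enough vw = ℕ.≤-trans (ℕ.≤-reflexive (cong (8 *_) (sym (weigh-in vw)))) (ℕ.m≤m+n _ _)

      balanced : ∀ {v} → Dec (v ∈ S) → Colourable S ⊎ Balanced v
      balanced (no v∉S)  = inj₂ (outside-balanced v∉S)
      balanced (yes v∈S) = case kinds v∈S of λ
        { (inj₁ (_ , _ , v-two))       → two-balanced v-two
        ; (inj₂ (_ , _ , _ , v-three)) → three-balanced v-three }

      all-balanced : (∀ v → Balanced v) → ¬ Sparse
      all-balanced balance sparse = ℕ.<⇒≱ sparse (ℕ.+-cancelʳ-≤ total _ _ (begin
        18 * sum indicator + total
          ≡⟨ cong (_+ total) (*-distribˡ-sum 18 indicator) ⟩
        sum (λ v → 18 * indicator v) + total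
          ≡⟨ ∑-distrib-+ (λ v → 18 * indicator v) (λ v → sum (flow v)) ⟨
        sum (λ v → 18 * indicator v + sum (flow v))
          ≤⟨ sum-mono balance ⟩
        sum (λ v → sum (income v))
          ≡⟨ sum-cong-≗ (λ v → ∑-distrib-+ (λ w → 8 * weigh v w 1) (λ w → flow w v)) ⟩
        sum (λ v → sum (λ w → 8 * weigh v w 1) + sum (λ w → flow w v))
          ≡⟨ ∑-distrib-+ (λ v → sum (λ w → 8 * weigh v w 1)) (λ v → sum (λ w → flow w v)) ⟩
        sum (λ v → sum (λ w → 8 * weigh v w 1)) + sum (λ v → sum (λ w → flow w v))
          -- Every unit sent along an edge arrives at its other end, so exchanging the sums gives
          -- the same `total` and it cancels.
          ≡⟨ cong₂ _+_ eight (∑-comm λ v w → flow w v) ⟩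
        8 * sum (λ v → sum (λ w → weigh v w 1)) + total ∎))
        where
        open ℕ.≤-Reasoning
        total : ℕ
        total = sum (λ v → sum (flow v))
        eight : sum (λ v → sum (λ w → 8 * weigh v w 1)) ≡ 8 * sum (λ v → sum (λ w → weigh v w 1))
        eight = trans (sum-cong-≗ λ v → sym (*-distribˡ-sum 8 (λ w → weigh v w 1)))
                      (sym (*-distribˡ-sum 8 (λ v → sum (λ w → weigh v w 1))))

    -- First every vertex of S gets its kind, then every vertex its balance. A reduction met on the
    -- way gives the colouring; balance everywhere contradicts sparsity.
    sparse-colourable : Sparse → Colourable S
    sparse-colourable sparse with either-all (λ v → decide-kind v)
      where
      decide-kind : ∀ v → Colourable S ⊎ (v ∈ S → Kind v)
      decide-kind v with v ∈? S
      ... | yes v∈S = Sum.map₂ (λ k _ → k) (kind v∈S)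
      ... | no v∉S  = inj₂ (⊥-elim ∘ v∉S)
    ... | inj₁ done = done
    ... | inj₂ kinds with either-all (λ v → balanced (λ {v} → kinds v) (v ∈? S))
    ...   | inj₁ done    = done
    ...   | inj₂ balance = ⊥-elim (all-balanced (λ {v} → kinds v) balance sparse)

-- Counting edges and the maximum average degree

module _ {A B : Set} (f : A → Maybe B) {P : B → Set} (P? : Decidable P) where

  -- Additive in xs, so that the length of a filtered `edges G` becomes a double sum over ordered
  -- pairs of vertices.
  hits : List A → ℕ
  hits xs = length (filter P? (mapMaybe f xs))

  hits-++ : ∀ xs ys → hits (xs ++ ys) ≡ hits xs + hits ys
  hits-++ xs ys = trans
    (cong (length ∘ filter P?) (trans (cong catMaybes (List.map-++ f xs ys)) (List.catMaybes-++ (map f xs) _)))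
    (trans (cong length (List.filter-++ P? (mapMaybe f xs) _)) (List.length-++ (filter P? (mapMaybe f xs))))

  hits-tabulate : ∀ {n} (g : Fin n → A) → hits (tabulate g) ≡ sum (λ i → hits (g i ∷ []))
  hits-tabulate {zero}  g = refl
  hits-tabulate {suc n} g =
    trans (hits-++ (g zero ∷ []) (tabulate (g ∘ suc))) (cong₂ _+_ refl (hits-tabulate (g ∘ suc)))

hits-cartesianProduct : ∀ {A B C : Set} (f : A × B → Maybe C) {P : C → Set} (P? : Decidable P) {m n}
  (g : Fin m → A) (h : Fin n → B) →
  hits f P? (cartesianProduct (tabulate g) (tabulate h)) ≡ sum (λ i → sum (λ j → hits f P? ((g i , h j) ∷ [])))
hits-cartesianProduct f P? {zero}  g h = refl
hits-cartesianProduct f P? {suc m} g h = trans (hits-++ f P? (map (g zero ,_) (tabulate h)) _)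
  (cong₂ _+_
    (trans (cong (hits f P?) (List.map-tabulate h (g zero ,_))) (hits-tabulate f P? ((g zero ,_) ∘ h)))
    (hits-cartesianProduct f P? (g ∘ suc) h))

∈-allSubsets : ∀ {n} (S : Subset n) → S ∈ₗ allSubsets n
∈-allSubsets Vec.[]                = here refl
∈-allSubsets (inside Vec.∷ S)      = ∈-++⁺ˡ (∈-map⁺ (inside Vec.∷_) (∈-allSubsets S))
∈-allSubsets {suc n} (outside Vec.∷ S) =
  ∈-++⁺ʳ (map (inside Vec.∷_) (allSubsets n)) (∈-map⁺ (outside Vec.∷_) (∈-allSubsets S))

filter-∈-sublists : ∀ {A : Set} {P : A → Set} (P? : Decidable P) xs → filter P? xs ∈ₗ sublists xs
filter-∈-sublists P? []       = here refl
filter-∈-sublists P? (x ∷ xs) with does (P? x)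
... | true  = ∈-++⁺ˡ (∈-map⁺ (x ∷_) (filter-∈-sublists P? xs))
... | false = ∈-++⁺ʳ (map (x ∷_) (sublists xs)) (filter-∈-sublists P? xs)

ratio-< : ∀ m d → ratio m (suc d) < + 9 / 4 → m * 4 ℕ.< 9 * suc d
-- The rational is in lowest terms; the equivalent unreduced fraction turns the inequality into
-- cross multiplication.
ratio-< m d lt with ℚᵘ.<-respˡ-≃ (ℚ.toℚᵘ-fromℚᵘ (mkℚᵘ (+ m) d)) (ℚ.toℚᵘ-mono-< lt)
... | *<* h = ℤ.drop‿+<+ (subst₂ ℤ._<_ (sym (ℤ.pos-* m 4)) (sym (ℤ.pos-* 9 (suc d))) h)

module Density {n} (G : Graph n) (ports : Ports G) (S : Subset n) where
  open Extension G ports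
  open Discharging G ports S
  open Data.List.Extrema (DecTotalOrder.totalOrder ℚ.≤-decTotalOrder) using (xs≤max)

  private
    V = Fin n

  inS? : Decidable λ (e : Edge G) → src e ∈ S × tgt e ∈ S
  inS? e = (src e ∈? S) ×-dec (tgt e ∈? S)

  edgesWithin : List (Edge G)
  edgesWithin = filter inS? (edges G)

  averageDegree≤mad : Nonempty S → averageDegree G (S , edgesWithin) ℚ.≤ mad G
  averageDegree≤mad S≠∅ = All.lookup (xs≤max 0ℚ (map (averageDegree G) (nonemptySubgraphs G)))
    (∈-map⁺ (averageDegree G) (∈-filter⁺ (isNonemptySubgraph? G)
      (∈-cartesianProduct⁺ (∈-allSubsets S) (filter-∈-sublists inS? (edges G)))
      (S≠∅ , all-filter inS? (edges G))))

  hit : V → V → ℕ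
  hit v w = hits (uncurry (edge? G)) inS? ((v , w) ∷ [])

  hit-edge : ∀ {v w} → v Fin.< w → Within v w → 1 ≤ hit v w
  hit-edge {v} {w} v<w (v∈S , w∈S , vw) with v Fin.<? w | adj G v w Bool.≟ true
  ... | no v≮w | _ = ⊥-elim (v≮w v<w)
  ... | yes _ | no ¬vw = ⊥-elim (¬vw vw)
  ... | yes _ | yes _ with v ∈? S | w ∈? S
  ...   | yes _   | yes _   = s≤s z≤n
  ...   | no v∉S  | _       = ⊥-elim (v∉S v∈S)
  ...   | yes _   | no w∉S  = ⊥-elim (w∉S w∈S)

  -- `edges` lists an edge in increasing order only, so an adjacent pair is accounted for either by
  -- itself or by its reverse.
  weigh≤hits : ∀ v w → weigh v w 1 ≤ hit v w + hit w v
  weigh≤hits v w = bound (within? v w)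
    where
    one : Within v w → 1 ≤ hit v w + hit w v
    one vw@(_ , _ , v~w) with Fin.<-cmp v w
    ... | tri< v<w _ _ = ℕ.≤-trans (hit-edge v<w vw) (ℕ.m≤m+n _ _)
    ... | tri≈ _ v≡w _ = ⊥-elim (adj-irrefl v~w v≡w)
    ... | tri> _ _ w<v = ℕ.≤-trans (hit-edge w<v (within-sym vw)) (ℕ.m≤n+m _ _)
    bound : Dec (Within v w) → weigh v w 1 ≤ hit v w + hit w v
    bound (yes vw) = ℕ.≤-trans (ℕ.≤-reflexive (weigh-in vw)) (one vw)
    bound (no ¬vw) = ℕ.≤-trans (ℕ.≤-reflexive (weigh-out ¬vw)) z≤n

  handshake : sum (λ v → sum (λ w → weigh v w 1)) ≤ 2 * length edgesWithin
  handshake = begin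
    sum (λ v → sum (λ w → weigh v w 1))
      ≤⟨ sum-mono (λ v → sum-mono (weigh≤hits v)) ⟩
    sum (λ v → sum (λ w → hit v w + hit w v))
      ≡⟨ sum-cong-≗ (λ v → ∑-distrib-+ (hit v) (λ w → hit w v)) ⟩
    sum (λ v → sum (hit v) + sum (λ w → hit w v))
      ≡⟨ ∑-distrib-+ (λ v → sum (hit v)) (λ v → sum (λ w → hit w v)) ⟩
    sum (λ v → sum (hit v)) + sum (λ v → sum (λ w → hit w v))
      ≡⟨ cong₂ _+_ refl (∑-comm λ v w → hit w v) ⟩
    sum (λ v → sum (hit v)) + sum (λ v → sum (hit v))
      ≡⟨ cong₂ _+_ count (trans count (sym (ℕ.+-identityʳ _))) ⟩
    2 * length edgesWithin ∎
    where
    open ℕ.≤-Reasoning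
    count : sum (λ v → sum (hit v)) ≡ length edgesWithin
    count = sym (hits-cartesianProduct (uncurry (edge? G)) inS? (λ v → v) (λ w → w))

size-indicator : ∀ {n} (S : Subset n) → sum (λ v → if does (v ∈? S) then 1 else 0) ≡ ∣ S ∣
size-indicator Vec.[]              = refl
size-indicator (inside Vec.∷ S)    = cong suc (size-indicator S)
size-indicator (outside Vec.∷ S)   = size-indicator S

nonempty⇒size≢0 : ∀ {n} {S : Subset n} → Nonempty S → ∃ λ d → ∣ S ∣ ≡ suc d
nonempty⇒size≢0 {S = S} (x , x∈S) with ∣ S ∣ | x∈p⇒∣p-x∣<∣p∣ x∈S
... | suc d | _ = d , refl

mad⇒sparse : ∀ {n} (G : Graph n) (ports : Ports G) (S : Subset n) → Nonempty S →
  mad G ℚ.< + 9 / 4 → Discharging.Sparse G ports S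
mad⇒sparse G ports S S≠∅ mad<9/4 with nonempty⇒size≢0 S≠∅
... | d , size≡ = begin-strict
  8 * sum (λ v → sum (λ w → weigh v w 1))
    ≤⟨ ℕ.*-monoʳ-≤ 8 handshake ⟩
  8 * (2 * length edgesWithin)
    -- The factors 8 and 18 are twice the 4 and 9 that cross multiplication gives.
    ≡⟨ regroup (2 * length edgesWithin) ⟩
  2 * (2 * length edgesWithin * 4)
    <⟨ ℕ.*-monoʳ-< 2 (ratio-< (2 * length edgesWithin) d
         (subst (λ k → ratio (2 * length edgesWithin) k < + 9 / 4) size≡
           (ℚ.≤-<-trans (averageDegree≤mad S≠∅) mad<9/4))) ⟩
  2 * (9 * suc d)
    ≡⟨ ℕ.*-assoc 2 9 (suc d) ⟨
  18 * suc d
    ≡⟨ cong (18 *_) (trans (size-indicator S) size≡) ⟨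
  18 * sum indicator ∎
  where
  open ℕ.≤-Reasoning
  open Discharging G ports S
  open Density G ports S
  regroup : ∀ m → 8 * m ≡ 2 * (m * 4)
  regroup = solve-∀

-- From colourings of ports to packing edge-colourings

degree≤3 : ∀ {n} (G : Graph n) → Subcubic G → ∀ v → degree G v ≤ 3
degree≤3 {n} G subcubic v = ℕ.≤-trans
  (All.lookup (ℕExtrema.xs≤max 0 (map (degree G) (allFin n))) (∈-map⁺ (degree G) (∈-allFin v))) subcubic

module Colouring {n} (G : Graph n) (ports : Ports G) (mad<9/4 : mad G < + 9 / 4) where
  open Ports ports
  open Extension G ports
  open Valid

  colourable : ∀ S → Colourable S
  colourable = WellFounded.All.wfRec ⊂-wellFounded _ Colourable step
    where
    step : ∀ S → (∀ {T} → T ⊂ S → Colourable T) → Colourable S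
    step S smaller with nonempty? S
    ... | yes S≠∅ = Discharging.sparse-colourable G ports S (λ T → smaller) (mad⇒sparse G ports S S≠∅ mad<9/4)
    -- The empty set has no links to control, but palettes must still be injective at every vertex.
    ... | no S=∅  = (λ _ → palette {0F} {1F} (λ ()) 0F 1F 2F) , record
      { injective = λ _ → palette-injective (λ ()) 0F 1F 2F ((λ ()) , (λ ()) , λ ())
      ; links     = λ v∈S _ _ → ⊥-elim (S=∅ (_ , v∈S)) }

  private
    c : Fin n → Palette
    c = proj₁ (colourable ⊤)

    valid : Valid (_∈ ⊤) c
    valid = proj₂ (colourable ⊤)

  Joins : Edge G → Fin n → Fin n → Set
  Joins e v w = (v ≡ src e × w ≡ tgt e) ⊎ (v ≡ tgt e × w ≡ src e)

  joins-unique : ∀ {e f v w} → Joins e v w → Joins f v w → e ≡ f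
  joins-unique {edge u v u<v a} {edge _ _ u<v′ a′} (inj₁ (refl , refl)) (inj₁ (refl , refl)) =
    cong₂ (edge u v) (Fin.<-irrelevant u<v u<v′) (Decidable⇒UIP.≡-irrelevant Bool._≟_ a a′)
  joins-unique {edge u v u<v a} {edge _ _ v<u _} (inj₁ (refl , refl)) (inj₂ (refl , refl)) =
    ⊥-elim (ℕ.<-asym u<v v<u)
  joins-unique {edge u v u<v a} {edge _ _ v<u _} (inj₂ (refl , refl)) (inj₁ (refl , refl)) =
    ⊥-elim (ℕ.<-asym u<v v<u)
  joins-unique {edge u v u<v a} {edge _ _ u<v′ a′} (inj₂ (refl , refl)) (inj₂ (refl , refl)) =
    cong₂ (edge u v) (Fin.<-irrelevant u<v u<v′) (Decidable⇒UIP.≡-irrelevant Bool._≟_ a a′)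

  joins-flip : ∀ {e v w} → Joins e v w → Joins e w v
  joins-flip (inj₁ (p , q)) = inj₂ (q , p)
  joins-flip (inj₂ (p , q)) = inj₁ (q , p)

  joins-adj : ∀ e {v w} → Joins e v w → Adj v w
  joins-adj e (inj₁ (refl , refl)) = adjacent e
  joins-adj e (inj₂ (refl , refl)) = adj-sym (adjacent e)

  far-end : ∀ e {v} → v IsEndpointOf e → ∃ (Joins e v)
  far-end e (inj₁ refl) = tgt e , inj₁ (refl , refl)
  far-end e (inj₂ refl) = src e , inj₂ (refl , refl)

  -- Read off at the lower end; since colours agree across links, the upper end gives the same, as
  -- `colour-at` shows.
  colour : Edge G → Color
  colour e = c (src e) (proj₁ (port-to (adjacent e)))

  colour-at : ∀ e {v w i} → Joins e v w → port v i ≡ just w → c v i ≡ colour e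
  colour-at e (inj₁ (refl , refl)) to = cong (c (src e)) (port-inj to (proj₂ (port-to (adjacent e))))
  colour-at e (inj₂ (refl , refl)) to =
    Compatible.agree (links valid ∈⊤ ∈⊤ (to , proj₂ (port-to (adjacent e))))

  incident-differ : ∀ {e f w} → e ≢ f → w IsEndpointOf e → w IsEndpointOf f → colour e ≢ colour f
  incident-differ {e} {f} {w} e≢f w∈e w∈f same
    with x , je ← far-end e w∈e
    with y , jf ← far-end f w∈f
    with i , toX ← port-to (joins-adj e je)
    with j , toY ← port-to (joins-adj f jf)
    with refl ← injective valid w i j (trans (colour-at e je toX) (trans same (sym (colour-at f jf toY))))
    with refl ← Maybe.just-injective (trans (sym toX) toY)
    = e≢f (joins-unique je jf)

  -- At the two ends of g, the edges e and f occupy ports other than that of g, and `separate`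
  -- compares exactly such ports.
  near-free : ∀ {e g f v w} → Joins g v w → e ≢ g → f ≢ g → v IsEndpointOf e → w IsEndpointOf f →
    colour e ≡ colour f → colour e ≡ 0c
  near-free {e} {g} {f} {v} {w} jg e≢g f≢g v∈e w∈f same
    with x , je ← far-end e v∈e
    with y , jf ← far-end f w∈f
    with i , toW ← port-to (joins-adj g jg)
    with j , toV ← port-to (joins-adj g (joins-flip {g} jg))
    with p , toX ← port-to (joins-adj e je)
    with q , toY ← port-to (joins-adj f jf)
    = trans (sym (colour-at e je toX))
        (Compatible.separate (links valid ∈⊤ ∈⊤ (toW , toV)) p q
          (λ { refl → e≢g (joins-unique je (subst (Joins g v) (Maybe.just-injective (trans (sym toW) toX)) jg)) })
          (λ { refl → f≢g (joins-unique jf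
                 (subst (Joins g w) (Maybe.just-injective (trans (sym toV) toY)) (joins-flip {g} jg))) })
          (trans (colour-at e je toX) (trans same (sym (colour-at f jf toY)))))

  weights : Vec.Vec ℕ 5
  weights = 1 Vec.∷ 2 ∷ 2 ∷ 2 ∷ 2 ∷ []

  weight≤2 : ∀ i → Vec.lookup weights i ≤ 2
  weight≤2 zero                      = s≤s z≤n
  weight≤2 (suc zero)                = ℕ.≤-refl
  weight≤2 (suc (suc zero))          = ℕ.≤-refl
  weight≤2 (suc (suc (suc zero)))    = ℕ.≤-refl
  weight≤2 (suc (suc (suc (suc zero)))) = ℕ.≤-refl

  packing : PackingEdgeColorable weights G
  packing = colour , separated
    where
    two-steps : ∀ {e g f} → e ≢ f → colour e ≡ colour f → LineAdj G e g → LineAdj G g f → colour e ≡ 0c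
    two-steps {e} {g} {f} e≢f same (e≢g , v , v∈e , v∈g) (g≢f , w , w∈g , w∈f) with v Fin.≟ w
    -- The walk uses the same end of g twice, so e and f already share an endpoint.
    ... | yes refl = ⊥-elim (incident-differ e≢f v∈e w∈f same)
    ... | no v≢w   = near-free (ends v∈g w∈g) e≢g (g≢f ∘ sym) v∈e w∈f same
      where
      ends : v IsEndpointOf g → w IsEndpointOf g → Joins g v w
      ends (inj₁ p) (inj₂ q) = inj₁ (p , q)
      ends (inj₂ p) (inj₁ q) = inj₂ (p , q)
      ends (inj₁ p) (inj₁ q) = ⊥-elim (v≢w (trans p (sym q)))
      ends (inj₂ p) (inj₂ q) = ⊥-elim (v≢w (trans p (sym q)))

    separated : ∀ e f → e ≢ f → colour e ≡ colour f →
      DistanceAtLeast (LineAdj G) (suc (Vec.lookup weights (colour e))) e f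
    separated e f e≢f same _ []                         = ⊥-elim (e≢f refl)
    separated e f e≢f same _ ((_ , _ , w∈e , w∈f) ∷ []) = ⊥-elim (incident-differ e≢f w∈e w∈f same)
    -- The common colour is 0, whose required distance 1 + 1 is the length of this walk.
    separated e f e≢f same _ (eg ∷ (gf ∷ [])) rewrite two-steps e≢f same eg gf = s≤s (s≤s z≤n)
    -- No class asks for a distance above 2 + 1, so three or more steps always suffice.
    separated e f e≢f same _ (_ ∷ (_ ∷ (_ ∷ _)))        =
      s≤s (ℕ.≤-trans (weight≤2 (colour e)) (s≤s (s≤s z≤n)))

mainTheorem4 : (n : ℕ) (G : Graph n) → Subcubic G → mad G < + 9 / 4 →
    PackingEdgeColorable (1 ∷ 2 ∷ 2 ∷ 2 ∷ 2 ∷ []) G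
mainTheorem4 n G subcubic = Colouring.packing G (portsOf G (degree≤3 G subcubic))
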